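{- For a pattern $p$, let $F_p(x,y)=\sum_{n\geq 0}\sum_{k\geq 0}a_{n,k}x^ny^k$, where $a_{n,k}$ is the number of paths in $\mathcal{D}_n^{h,\geq}$ containing exactly $k$ occurrences of $p$. Let $A=(x+1)(x^2y-x^2+xy-x-1)(x^3y-x^3-2x^2y+2x^2+xy+2x-1)$, $B=(x+1)(x^2y-x^2+1)(x^3y-x^3-3x^2y+3x^2-3x+1)$, $C=(x+1)(x^2y-x^2+1)(x^3y-x^3-3x^2y+3x^2-3x+1)$, $D=(xy+1)(x^2y-x^2-xy+x-1)(x^3y^2-x^3y-x^2y^2-2x^2y+3x^2+2xy+x-1)$. Then $$F_{UDU}(x,y)=\frac{1+x(x^2-x^2y-y)-\sqrt{A}}{2x^2(x-xy+1)},$$ $$F_{UDD}(x,y)=\frac{1+x(x^2y-x^2-xy+x-1)-\sqrt{B}}{2x^2(xy-x+1)^2},$$ $$F_{DDU}(x,y)=\frac{1+x(2x^2y^2-3x^2y+x^2+xy-x-1)-\sqrt{C}}{2x^2y(xy-x+1)},$$ $$F_{DDD}(x,y)=\frac{1-x(x^2y^2-x^2y-xy^2+x+1)-\sqrt{D}}{2x^2(xy-x-y)^2}.$$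
   Context: Dyck paths are lattice paths with steps $U=(1,1)$, $D=(1,-1)$ from $(0,0)$ to $(2n,0)$ never going below the $x$-axis ($n$ is the semilength). Every nonempty Dyck path $P$ has a unique first return decomposition $P=U\alpha D\beta$ with $\alpha,\beta$ Dyck paths. Let $h(P)$ denote the maximal height of a Dyck path. The set $\mathcal{D}^{h,\geq}$ is defined recursively: it contains the empty path, and a nonempty Dyck path $P=U\alpha D\beta$ belongs to $\mathcal{D}^{h,\geq}$ iff $\alpha,\beta\in\mathcal{D}^{h,\geq}$ and $h(U\alpha D)\geq h(\beta)$. $\mathcal{D}_n^{h,\geq}$ is the set of its elements of semilength $n$. An occurrence of a pattern in a path is an occurrence as a sequence of consecutive steps. -}

module Defs where

open import Data.Bool using (Bool; true; false; _∧_; if_then_else_)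
open import Data.Nat as ℕ using (ℕ; zero; suc; _∸_; _⊔_; _≤ᵇ_)
open import Data.Integer as ℤ using (ℤ; +_)
open import Data.List using (List; []; _∷_; _++_; length; filter; concatMap; map; applyUpTo)
open import Data.Product using (_×_; _,_)
open import Relation.Binary.PropositionalEquality using (_≡_)
open import Relation.Nullary.Decidable using (Dec; yes; no)
import Data.Bool

data Step : Set where
  U D : Step

_≟ˢ_ : Step → Step → Bool
U ≟ˢ U = true
D ≟ˢ D = true
_ ≟ˢ _ = false

-- A Dyck path, represented through its (unique) first return
-- decomposition:  ε is the empty path,  ret α β  is the path  U α D β.
data Dyck : Set where
  ε   : Dyck
  ret : Dyck → Dyck → Dyck

steps : Dyck → List Step
steps ε         = []
steps (ret α β) = U ∷ steps α ++ D ∷ steps β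

semilength : Dyck → ℕ
semilength ε         = 0
semilength (ret α β) = suc (semilength α ℕ.+ semilength β)

height : Dyck → ℕ
height ε         = 0
height (ret α β) = suc (height α) ⊔ height β

inDh≥ : Dyck → Bool
inDh≥ ε         = true
inDh≥ (ret α β) = inDh≥ α ∧ inDh≥ β ∧ (height β ≤ᵇ suc (height α))

-- all Dyck paths in which every branch of the decomposition tree has
-- at most d nested "ret"s; it contains every Dyck path of semilength ≤ d,
-- each exactly once
boundedDyck : ℕ → List Dyck
boundedDyck zero    = ε ∷ []
boundedDyck (suc d) =
  ε ∷ concatMap (λ α → map (ret α) (boundedDyck d)) (boundedDyck d)

allDyck : ℕ → List Dyck
allDyck n = filter (λ P → semilength P ℕ.≟ n) (boundedDyck n)

isPrefix : List Step → List Step → Bool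
isPrefix []       _        = true
isPrefix (_ ∷ _)  []       = false
isPrefix (a ∷ p)  (b ∷ w)  = (a ≟ˢ b) ∧ isPrefix p w

occurrences : List Step → List Step → ℕ
occurrences p []        = if isPrefix p [] then 1 else 0
occurrences p (b ∷ w)   = (if isPrefix p (b ∷ w) then 1 else 0) ℕ.+ occurrences p w

count : List Step → ℕ → ℕ → ℕ
count p n k =
  length (filter (λ P → occurrences p (steps P) ℕ.≟ k)
                 (filter (λ P → inDh≥ P Data.Bool.≟ true) (allDyck n)))

-- formal power series in x, y with integer coefficients:
-- f n k is the coefficient of x^n y^k

PS : Set
PS = ℕ → ℕ → ℤ

F : List Step → PS
F p n k = + count p n k

_≈_ : PS → PS → Set
f ≈ g = ∀ n k → f n k ≡ g n k
infix 4 _≈_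

cst : ℤ → PS
cst c zero zero = c
cst c _    _    = + 0

𝕩 : PS
𝕩 1 0 = + 1
𝕩 _ _ = + 0

𝕪 : PS
𝕪 0 1 = + 1
𝕪 _ _ = + 0

_⊕_ : PS → PS → PS
(f ⊕ g) n k = f n k ℤ.+ g n k

_⊝_ : PS → PS → PS
(f ⊝ g) n k = f n k ℤ.- g n k

sumTo : ℕ → (ℕ → ℤ) → ℤ
sumTo zero    f = f 0
sumTo (suc n) f = sumTo n f ℤ.+ f (suc n)

_⊛_ : PS → PS → PS
(f ⊛ g) n k = sumTo n (λ i → sumTo k (λ j → f i j ℤ.* g (n ∸ i) (k ∸ j)))

infixl 6 _⊕_ _⊝_
infixl 7 _⊛_

_^^_ : PS → ℕ → PS
f ^^ zero  = cst (+ 1)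
f ^^ suc m = f ⊛ (f ^^ m)
infixr 8 _^^_

-- G = √H in the ring of formal power series: G² = H and G(0,0) = 1
-- (for H with constant term 1 this determines G uniquely)
IsSqrt : PS → PS → Set
IsSqrt G H = (G ⊛ G ≈ H) × (G 0 0 ≡ + 1)

-- "F = (N - √H) / Den" as an identity of formal power series:
-- N - Den·F is the square root of H
ClosedForm : PS → PS → PS → PS → Set
ClosedForm Fp N H Den = IsSqrt (N ⊝ Den ⊛ Fp) H

pUDU pUDD pDDU pDDD : List Step
pUDU = U ∷ D ∷ U ∷ []
pUDD = U ∷ D ∷ D ∷ []
pDDU = D ∷ D ∷ U ∷ []
pDDD = D ∷ D ∷ D ∷ []

x y 𝟙 𝟚 𝟛 : PS
x = 𝕩
y = 𝕪
𝟙 = cst (+ 1)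
𝟚 = cst (+ 2)
𝟛 = cst (+ 3)

Aₚ : PS
Aₚ = (x ⊕ 𝟙) ⊛ (x ^^ 2 ⊛ y ⊝ x ^^ 2 ⊕ x ⊛ y ⊝ x ⊝ 𝟙)
     ⊛ (x ^^ 3 ⊛ y ⊝ x ^^ 3 ⊝ 𝟚 ⊛ x ^^ 2 ⊛ y ⊕ 𝟚 ⊛ x ^^ 2 ⊕ x ⊛ y ⊕ 𝟚 ⊛ x ⊝ 𝟙)

Bₚ : PS
Bₚ = (x ⊕ 𝟙) ⊛ (x ^^ 2 ⊛ y ⊝ x ^^ 2 ⊕ 𝟙)
     ⊛ (x ^^ 3 ⊛ y ⊝ x ^^ 3 ⊝ 𝟛 ⊛ x ^^ 2 ⊛ y ⊕ 𝟛 ⊛ x ^^ 2 ⊝ 𝟛 ⊛ x ⊕ 𝟙)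

Cₚ : PS
Cₚ = (x ⊕ 𝟙) ⊛ (x ^^ 2 ⊛ y ⊝ x ^^ 2 ⊕ 𝟙)
     ⊛ (x ^^ 3 ⊛ y ⊝ x ^^ 3 ⊝ 𝟛 ⊛ x ^^ 2 ⊛ y ⊕ 𝟛 ⊛ x ^^ 2 ⊝ 𝟛 ⊛ x ⊕ 𝟙)

Dₚ : PS
Dₚ = (x ⊛ y ⊕ 𝟙) ⊛ (x ^^ 2 ⊛ y ⊝ x ^^ 2 ⊝ x ⊛ y ⊕ x ⊝ 𝟙)
     ⊛ (x ^^ 3 ⊛ y ^^ 2 ⊝ x ^^ 3 ⊛ y ⊝ x ^^ 2 ⊛ y ^^ 2 ⊝ 𝟚 ⊛ x ^^ 2 ⊛ y
        ⊕ 𝟛 ⊛ x ^^ 2 ⊕ 𝟚 ⊛ x ⊛ y ⊕ x ⊝ 𝟙)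

N-UDU Den-UDU : PS
N-UDU   = 𝟙 ⊕ x ⊛ (x ^^ 2 ⊝ x ^^ 2 ⊛ y ⊝ y)
Den-UDU = 𝟚 ⊛ x ^^ 2 ⊛ (x ⊝ x ⊛ y ⊕ 𝟙)

N-UDD Den-UDD : PS
N-UDD   = 𝟙 ⊕ x ⊛ (x ^^ 2 ⊛ y ⊝ x ^^ 2 ⊝ x ⊛ y ⊕ x ⊝ 𝟙)
Den-UDD = 𝟚 ⊛ x ^^ 2 ⊛ (x ⊛ y ⊝ x ⊕ 𝟙) ^^ 2

N-DDU Den-DDU : PS
N-DDU   = 𝟙 ⊕ x ⊛ (𝟚 ⊛ x ^^ 2 ⊛ y ^^ 2 ⊝ 𝟛 ⊛ x ^^ 2 ⊛ y ⊕ x ^^ 2 ⊕ x ⊛ y ⊝ x ⊝ 𝟙)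
Den-DDU = 𝟚 ⊛ x ^^ 2 ⊛ y ⊛ (x ⊛ y ⊝ x ⊕ 𝟙)

N-DDD Den-DDD : PS
N-DDD   = 𝟙 ⊝ x ⊛ (x ^^ 2 ⊛ y ^^ 2 ⊝ x ^^ 2 ⊛ y ⊝ x ⊛ y ^^ 2 ⊕ x ⊕ 𝟙)
Den-DDD = 𝟚 ⊛ x ^^ 2 ⊛ (x ⊛ y ⊝ x ⊝ y) ^^ 2

{-# OPTIONS --safe #-}
-- Let A k and B k be the generating functions of the paths of height exactly k and
-- at most k. In the first return decomposition of a path of height k + 1, α has height
-- exactly k and β has height at most k + 1, so B (k+1) = B k + A (k+1) and, for k large,
-- A (k+1) = q A k B (k+1). Here q = x for UDU and DDU, after replacing B by v B + 1 − v
-- and A by v A, where v is the weight of a crossing occurrence between nonempty α and β;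
-- for UDD and DDD the crossing depends on whether α ends with a peak, and the paths that
-- do so have generating function x A k, which gives a polynomial q. Along the recurrence
--     (1 + q² B² − q A (1 + q B)) / B
-- is constant, equal to some j / w read off from the first terms. As A k tends to 0, the
-- limit F of B k satisfies w (1 + q² F²) = j F, so (j − 2 q² w F)² = j² − 4 q² w².
-- Coefficients of x^n are computed modulo x^(n+1), where x is nilpotent and the limit is
-- attained.
module Submission where

open import Defs
open import Algebra.Bundles using (CommutativeRing; RawRing)
open import Algebra.Morphism.Structures using (IsRingMonomorphism)
import Algebra.Morphism.RingMonomorphism as RingMonomorphism
import Algebra.Solver.Ring
open import Algebra.Solver.Ring.AlmostCommutativeRing
  using (fromCommutativeRing; _-Raw-AlmostCommutative⟶_; Induced-equivalence)
import Data.Bool as Bool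
open import Data.Bool.Base using (Bool; true; false; _∧_; if_then_else_)
open import Data.Bool.Properties using (∧-zeroʳ; ∧-identityʳ)
open import Data.Integer.Base as ℤ using (ℤ; +_)
import Data.Integer.Properties as ℤ
open import Data.List.Base using (List; []; _∷_; _++_; map; concatMap; filter; length)
open import Data.List.Properties using (++-assoc)
import Data.Maybe.Base as Maybe
open import Data.Nat.Base as ℕ using (ℕ; zero; suc; _∸_; _⊔_; _≡ᵇ_; _≤ᵇ_; z≤n; s≤s)
import Data.Nat.Properties as ℕ
open import Data.Product using (_×_; _,_; ∃)
open import Function.Base using (_∘_; id)
open import Level using (0ℓ)
open import Relation.Binary.Definitions using (WeaklyDecidable; tri<; tri≈; tri>)
open import Relation.Binary.PropositionalEquality as ≡ using (_≡_; cong; cong₂)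
open import Relation.Nullary.Decidable using (dec⇒maybe; yes; no; does)
open import Relation.Nullary.Negation using (contradiction)
open import Relation.Unary using (Decidable)

-- Truncated power series

module TruncatedSeries (R : CommutativeRing 0ℓ 0ℓ) (N : ℕ) where
  open CommutativeRing R renaming (_≈_ to _≋_)
  open import Relation.Binary.Reasoning.Setoid setoid

  Series : Set
  Series = ℕ → Carrier

  infix 4 _≈ₙ_
  _≈ₙ_ : Series → Series → Set
  f ≈ₙ g = ∀ {n} → n ℕ.≤ N → f n ≋ g n

  infixl 7 _⋆_
  -- The Cauchy product, peeling off the first coefficient of the left factor, so that the ring laws
  -- go by induction on the index; `⊛≡⋆` identifies it with the product by `sumTo`.
  _⋆_ : Series → Series → Series
  (f ⋆ g) zero    = f 0 * g 0
  (f ⋆ g) (suc n) = f 0 * g (suc n) + ((f ∘ suc) ⋆ g) n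

  one : Series
  one zero    = 1#
  one (suc _) = 0#

  -- Coefficient `n` of a product involves only coefficients up to `n`; hence the product respects
  -- equality up to the truncation order.
  ⋆-cong : ∀ {f f′ g g′} n → (∀ {i} → i ℕ.≤ n → f i ≋ f′ i) →
           (∀ {i} → i ℕ.≤ n → g i ≋ g′ i) → (f ⋆ g) n ≋ (f′ ⋆ g′) n
  ⋆-cong zero    p q = *-cong (p z≤n) (q z≤n)
  ⋆-cong (suc n) p q =
    +-cong (*-cong (p z≤n) (q ℕ.≤-refl)) (⋆-cong n (p ∘ s≤s) (q ∘ ℕ.m≤n⇒m≤1+n))

  ⋆-scaleˡ : ∀ c f g n → ((λ i → c * f i) ⋆ g) n ≋ c * (f ⋆ g) n
  ⋆-scaleˡ c f g zero    = *-assoc c (f 0) (g 0)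
  ⋆-scaleˡ c f g (suc n) = begin
    c * f 0 * g (suc n) + ((λ i → c * f (suc i)) ⋆ g) n
      ≈⟨ +-cong (*-assoc c _ _) (⋆-scaleˡ c (f ∘ suc) g n) ⟩
    c * (f 0 * g (suc n)) + c * ((f ∘ suc) ⋆ g) n
      ≈⟨ distribˡ c _ _ ⟨
    c * (f 0 * g (suc n) + ((f ∘ suc) ⋆ g) n) ∎

  interchange : ∀ a b c d → a + b + (c + d) ≋ a + c + (b + d)
  interchange = CSProp.interchange
    where import Algebra.Properties.CommutativeSemigroup +-commutativeSemigroup as CSProp

  ⋆-distribʳ : ∀ h f g n → ((λ i → f i + g i) ⋆ h) n ≋ (f ⋆ h) n + (g ⋆ h) n
  ⋆-distribʳ h f g zero    = distribʳ (h 0) (f 0) (g 0)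
  ⋆-distribʳ h f g (suc n) = begin
    (f 0 + g 0) * h (suc n) + ((λ i → f (suc i) + g (suc i)) ⋆ h) n
      ≈⟨ +-cong (distribʳ _ _ _) (⋆-distribʳ h (f ∘ suc) (g ∘ suc) n) ⟩
    f 0 * h (suc n) + g 0 * h (suc n) + (((f ∘ suc) ⋆ h) n + ((g ∘ suc) ⋆ h) n)
      ≈⟨ interchange _ _ _ _ ⟩
    (f ⋆ h) (suc n) + (g ⋆ h) (suc n) ∎

  ⋆-assoc : ∀ f g h n → ((f ⋆ g) ⋆ h) n ≋ (f ⋆ (g ⋆ h)) n
  ⋆-assoc f g h zero    = *-assoc (f 0) (g 0) (h 0)
  ⋆-assoc f g h (suc n) = begin
    f 0 * g 0 * h (suc n) + (((λ i → f 0 * g (suc i) + ((f ∘ suc) ⋆ g) i)) ⋆ h) n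
      ≈⟨ +-cong (*-assoc _ _ _) (⋆-distribʳ h _ _ n) ⟩
    f 0 * (g 0 * h (suc n)) + (((λ i → f 0 * g (suc i)) ⋆ h) n + (((f ∘ suc) ⋆ g) ⋆ h) n)
      ≈⟨ +-congˡ (+-cong (⋆-scaleˡ (f 0) (g ∘ suc) h n) (⋆-assoc (f ∘ suc) g h n)) ⟩
    f 0 * (g 0 * h (suc n)) + (f 0 * ((g ∘ suc) ⋆ h) n + ((f ∘ suc) ⋆ (g ⋆ h)) n)
      ≈⟨ +-assoc _ _ _ ⟨
    f 0 * (g 0 * h (suc n)) + f 0 * ((g ∘ suc) ⋆ h) n + ((f ∘ suc) ⋆ (g ⋆ h)) n
      ≈⟨ +-congʳ (distribˡ _ _ _) ⟨
    (f ⋆ (g ⋆ h)) (suc n) ∎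

  -- The convolution peeled at its other end, which is where commuting the factors sends the first
  -- term.
  ⋆-unrollʳ : ∀ f g n → (f ⋆ g) (suc n) ≋ (f ⋆ (g ∘ suc)) n + f (suc n) * g 0
  ⋆-unrollʳ f g zero    = refl
  ⋆-unrollʳ f g (suc n) =
    trans (+-congˡ (⋆-unrollʳ (f ∘ suc) g n)) (sym (+-assoc _ _ _))

  ⋆-comm : ∀ f g n → (f ⋆ g) n ≋ (g ⋆ f) n
  ⋆-comm f g zero    = *-comm (f 0) (g 0)
  ⋆-comm f g (suc n) = begin
    f 0 * g (suc n) + ((f ∘ suc) ⋆ g) n ≈⟨ +-cong (*-comm _ _) (⋆-comm (f ∘ suc) g n) ⟩
    g (suc n) * f 0 + (g ⋆ (f ∘ suc)) n ≈⟨ +-comm _ _ ⟩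
    (g ⋆ (f ∘ suc)) n + g (suc n) * f 0 ≈⟨ ⋆-unrollʳ g f n ⟨
    (g ⋆ f) (suc n) ∎

  ⋆-zeroˡ : ∀ g n → ((λ _ → 0#) ⋆ g) n ≋ 0#
  ⋆-zeroˡ g zero    = zeroˡ (g 0)
  ⋆-zeroˡ g (suc n) = trans (+-cong (zeroˡ _) (⋆-zeroˡ g n)) (+-identityˡ 0#)

  ⋆-identityˡ : ∀ g n → (one ⋆ g) n ≋ g n
  ⋆-identityˡ g zero    = *-identityˡ (g 0)
  ⋆-identityˡ g (suc n) =
    trans (+-cong (*-identityˡ _) (⋆-zeroˡ g n)) (+-identityʳ _)

  commutativeRing : CommutativeRing 0ℓ 0ℓ
  commutativeRing = record
    { Carrier = Series ; _≈_ = _≈ₙ_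
    ; _+_ = λ f g n → f n + g n ; _*_ = _⋆_ ; -_ = λ f n → - f n
    ; 0# = λ _ → 0# ; 1# = one
    ; isCommutativeRing = record
      { isRing = record
        { +-isAbelianGroup = record
          { isGroup = record
            { isMonoid = record
              { isSemigroup = record
                { isMagma = record
                  { isEquivalence = record
                    { refl = λ _ → refl
                    ; sym = λ p i → sym (p i)
                    ; trans = λ p q i → trans (p i) (q i) }
                  ; ∙-cong = λ p q i → +-cong (p i) (q i) }
                ; assoc = λ f g h _ → +-assoc _ _ _ }
              ; identity = (λ f _ → +-identityˡ _) , (λ f _ → +-identityʳ _) }
            ; inverse = (λ f _ → -‿inverseˡ _) , (λ f _ → -‿inverseʳ _)
            ; ⁻¹-cong = λ p i → -‿cong (p i) }
          ; comm = λ f g _ → +-comm _ _ }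
        ; *-cong = λ p q {n} n≤N → ⋆-cong n (λ i≤n → p (ℕ.≤-trans i≤n n≤N))
                                            (λ i≤n → q (ℕ.≤-trans i≤n n≤N))
        ; *-assoc = λ f g h {n} _ → ⋆-assoc f g h n
        ; *-identity = (λ g {n} _ → ⋆-identityˡ g n)
                     , (λ g {n} _ → trans (⋆-comm g one n) (⋆-identityˡ g n))
        ; distrib = (λ f g h {n} _ → trans (⋆-comm f _ n) (trans (⋆-distribʳ f g h n)
                      (+-cong (⋆-comm g f n) (⋆-comm h f n))))
                  , (λ h f g {n} _ → ⋆-distribʳ h f g n) }
      ; *-comm = λ f g {n} _ → ⋆-comm f g n } }

-- Height recurrences over a ring with a nilpotent element

exactly atMost : ℕ → Dyck → Bool
exactly k P = inDh≥ P ∧ (height P ≡ᵇ k)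
atMost  k P = inDh≥ P ∧ (height P ≤ᵇ k)

isEmpty endsUD : Dyck → Bool
isEmpty ε         = true
isEmpty (ret _ _) = false
endsUD ε               = false
endsUD (ret α ε)       = isEmpty α
endsUD (ret α (ret β γ)) = endsUD (ret β γ)

≤ᵇ-true : ∀ {m n} → m ℕ.≤ n → (m ≤ᵇ n) ≡ true
≤ᵇ-true {m} {n} m≤n with m ≤ᵇ n | ℕ.≤⇒≤ᵇ m≤n
... | true | _ = ≡.refl

≤ᵇ-false : ∀ {m n} → n ℕ.< m → (m ≤ᵇ n) ≡ false
≤ᵇ-false {m} {n} n<m with m ≤ᵇ n | ℕ.≤ᵇ⇒≤ m n
... | true  | m≤n = contradiction (m≤n _) (ℕ.<⇒≱ n<m)
... | false | _   = ≡.refl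

≡ᵇ-refl : ∀ n → (n ≡ᵇ n) ≡ true
≡ᵇ-refl zero    = ≡.refl
≡ᵇ-refl (suc n) = ≡ᵇ-refl n

≡ᵇ-false : ∀ {m n} → m ≡.≢ n → (m ≡ᵇ n) ≡ false
≡ᵇ-false {m} {n} m≢n with m ≡ᵇ n | ℕ.≡ᵇ⇒≡ m n
... | true  | p = contradiction (p _) m≢n
... | false | _ = ≡.refl

-- Under `b ≤ suc a` the maximum is `suc a`, so it equals `suc k` only for `a = k`, and then the
-- bound on `b` mentions `k` alone.
heights-ret : ∀ a b k → (b ≤ᵇ suc a) ∧ (suc a ⊔ b ≡ᵇ suc k) ≡ (a ≡ᵇ k) ∧ (b ≤ᵇ suc k)
heights-ret a b k with b ℕ.≤? suc a
... | no b≰ rewrite ≤ᵇ-false (ℕ.≰⇒> b≰) with a ℕ.≟ k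
...   | yes ≡.refl rewrite ≡ᵇ-refl a | ≤ᵇ-false (ℕ.≰⇒> b≰) = ≡.refl
...   | no a≢k rewrite ≡ᵇ-false a≢k = ≡.refl
heights-ret a b k | yes b≤ rewrite ≤ᵇ-true b≤ | ℕ.m≥n⇒m⊔n≡m b≤ with a ℕ.≟ k
...   | yes ≡.refl rewrite ≡ᵇ-refl a | ≤ᵇ-true b≤ = ≡.refl
...   | no a≢k rewrite ≡ᵇ-false a≢k = ≡.refl

-- Fixing the height of the whole path decouples the conditions on α and β, so the sum over paths of
-- a given height becomes a product.
exactly-ret : ∀ k α β → exactly (suc k) (ret α β) ≡ exactly k α ∧ atMost (suc k) β
exactly-ret k α β with inDh≥ α | inDh≥ β
... | false | _     = ≡.refl
... | true  | false = ≡.sym (∧-zeroʳ _)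
... | true  | true  = heights-ret (height α) (height β) k

height≤semilength : ∀ P → height P ℕ.≤ semilength P
height≤semilength ε         = z≤n
height≤semilength (ret α β) = ℕ.⊔-lub
  (s≤s (ℕ.≤-trans (height≤semilength α) (ℕ.m≤m+n _ _)))
  (ℕ.m≤n⇒m≤1+n (ℕ.≤-trans (height≤semilength β) (ℕ.m≤n+m _ _)))

height-ret>0 : ∀ α β → 0 ℕ.< height (ret α β)
height-ret>0 α β = ℕ.≤-trans (s≤s z≤n) (ℕ.m≤m⊔n (suc (height α)) (height β))

exactly-0-ret : ∀ α β → exactly 0 (ret α β) ≡ false
exactly-0-ret α β rewrite ≡ᵇ-false {suc (height α) ⊔ height β} {0} (ℕ.>⇒≢ (height-ret>0 α β)) = ∧-zeroʳ _

ℤ-rawRing : RawRing 0ℓ 0ℓ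
ℤ-rawRing = CommutativeRing.rawRing ℤ.+-*-commutativeRing

module NilpotentRing
  (R : CommutativeRing 0ℓ 0ℓ)
  (morphism : ℤ-rawRing -Raw-AlmostCommutative⟶ fromCommutativeRing R) where

  open CommutativeRing R renaming (_≈_ to _≋_) hiding (0#; 1#)
  open _-Raw-AlmostCommutative⟶_ morphism renaming (⟦_⟧ to ι)
  open import Algebra.Properties.Semiring.Exp semiring using (_^_)
  open import Relation.Binary.Reasoning.Setoid setoid

  ι-≟ : WeaklyDecidable (Induced-equivalence morphism)
  ι-≟ a b = Maybe.map (λ a≡b → reflexive (cong ι a≡b)) (dec⇒maybe (a ℤ.≟ b))

  open Algebra.Solver.Ring ℤ-rawRing (fromCommutativeRing R) morphism ι-≟
    using (solve; _:=_; _:+_; _:*_; _:-_; con)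

  -- The images of ι, not the constants of R: these are what the solver's con denotes.
  0# 1# 2# : Carrier
  0# = ι (+ 0)
  1# = ι (+ 1)
  2# = ι (+ 2)

  -- An occurrence of UDU or DDU lying inside neither α nor β ends with the first step of β; it is
  -- UDU for α empty and DDU otherwise.
  emptinessFactor : Carrier → Carrier → Dyck → Dyck → Carrier
  emptinessFactor u v α β = if isEmpty β then 1# else if isEmpty α then u else v

  -- An occurrence of UDD or DDD lying inside neither α nor β consists of the last two steps of α
  -- and the `D` after α.
  peakFactor : Carrier → Carrier → Dyck → Carrier
  peakFactor s t α = if isEmpty α then 1# else if endsUD α then s else t

  *-zeroʳ : ∀ a → a * 0# ≋ 0#
  *-zeroʳ = solve 1 (λ a → a :* con (+ 0) := con (+ 0)) refl

  *-zeroˡ : ∀ a → 0# * a ≋ 0#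
  *-zeroˡ = solve 1 (λ a → con (+ 0) :* a := con (+ 0)) refl

  *1 : ∀ a → a * 1# ≋ a
  *1 = solve 1 (λ a → a :* con (+ 1) := a) refl

  regroup : ∀ ν a b c d e → ν * (a * b) * (c * d * e) ≋ ν * (a * c * (b * d) * e)
  regroup = solve 6 (λ ν a b c d e → ν :* (a :* b) :* (c :* d :* e) := ν :* (a :* c :* (b :* d) :* e)) refl

  module Nilpotent (ν : Carrier) (N : ℕ) (ν^N≋0 : ν ^ N ≋ 0#) where

    -- `1 − ν g` is a unit because ν is nilpotent; substituting the equation into itself `N` times
    -- avoids writing the inverse.
    nilpotent-cancel : ∀ {z} g → z ≋ ν * (g * z) → z ≋ 0#
    nilpotent-cancel {z} g z≋ = begin
      z                     ≈⟨ iterate N ⟩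
      ν ^ N * (g ^ N * z)   ≈⟨ *-congʳ ν^N≋0 ⟩
      0# * (g ^ N * z)      ≈⟨ *-zeroˡ _ ⟩
      0#                    ∎
      where
      iterate : ∀ m → z ≋ ν ^ m * (g ^ m * z)
      iterate zero    = sym (trans (*-identityˡ _) (*-identityˡ z))
      iterate (suc m) = begin
        z ≈⟨ z≋ ⟩
        ν * (g * z) ≈⟨ *-congˡ (*-congˡ (iterate m)) ⟩
        ν * (g * (ν ^ m * (g ^ m * z)))
          ≈⟨ solve 5 (λ ν g p q z → ν :* (g :* (p :* (q :* z))) := ν :* p :* (g :* q :* z))
               refl ν g (ν ^ m) (g ^ m) z ⟩
        ν ^ suc m * (g ^ suc m * z) ∎

    fixpoint-unique : ∀ {c a b} g → a ≋ c + ν * (g * a) → b ≋ c + ν * (g * b) → a ≋ b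
    fixpoint-unique {c} {a} {b} g a≋ b≋ = begin
      a         ≈⟨ solve 2 (λ a b → a := a :- b :+ b) refl a b ⟩
      a - b + b ≈⟨ +-congʳ (nilpotent-cancel g difference) ⟩
      0# + b    ≈⟨ solve 1 (λ b → con (+ 0) :+ b := b) refl b ⟩
      b ∎
      where
      difference : a - b ≋ ν * (g * (a - b))
      difference = trans (+-cong a≋ (-‿cong b≋))
        (solve 5 (λ c ν g a b → c :+ ν :* (g :* a) :- (c :+ ν :* (g :* b)) := ν :* (g :* (a :- b)))
          refl c ν g a b)

    -- The invariant of the height recurrence and its discriminant

    module HeightRecurrence (r w j : Carrier) where

      -- The explicit factor ν is what lets `nilpotent-cancel` divide by `1 − q a`.
      q : Carrier
      q = ν * r

      -- The claim that `(1 + q² b² − q a (1 + q b)) / b` equals `j / w`, cleared of denominators.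
      defect : Carrier → Carrier → Carrier
      defect a b = w * (1# + q * q * (b * b) - q * a * (1# + q * b)) - j * b

      defect-congʳ : ∀ {a b₁ b₂} → b₁ ≋ b₂ → defect a b₁ ≋ defect a b₂
      defect-congʳ p = +-cong
        (*-congˡ (+-cong (+-congˡ (*-congˡ (*-cong p p))) (-‿cong (*-congˡ (+-congˡ (*-congˡ p))))))
        (-‿cong (*-congˡ p))

      -- (1 − q a) · defect a′ b′ = defect a b modulo the two recurrences.
      defect-step : ∀ {a b a′ b′} → b′ ≋ b + a′ → a′ ≋ q * (a * b′) →
                    defect a b ≋ 0# → defect a′ b′ ≋ 0#
      defect-step {a} {b} {a′} {b′} b′≋ a′≋ d≋0 = nilpotent-cancel (r * a) (begin
        defect a′ b′
          ≈⟨ solve 6 (λ w j q a a′ b′ →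
               w :* (con (+ 1) :+ q :* q :* (b′ :* b′) :- q :* a′ :* (con (+ 1) :+ q :* b′)) :- j :* b′
               := (w :* (con (+ 1) :+ q :* q :* ((b′ :- a′) :* (b′ :- a′))
                     :- q :* a :* (con (+ 1) :+ q :* (b′ :- a′))) :- j :* (b′ :- a′))
                  :+ (w :* q :* (q :* b′ :- q :* a′ :- con (+ 1)) :- j) :* (a′ :- q :* (a :* b′))
                  :+ q :* a :* (w :* (con (+ 1) :+ q :* q :* (b′ :* b′)
                     :- q :* a′ :* (con (+ 1) :+ q :* b′)) :- j :* b′))
               refl w j q a a′ b′ ⟩
        defect a (b′ - a′) + c * (a′ - q * (a * b′)) + q * a * defect a′ b′
          ≈⟨ +-congʳ (+-cong (trans (defect-congʳ b≋) d≋0) (*-congˡ residue)) ⟩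
        0# + c * 0# + q * a * defect a′ b′
          ≈⟨ solve 5 (λ c ν r a d → con (+ 0) :+ c :* con (+ 0) :+ ν :* r :* a :* d
               := ν :* (r :* a :* d)) refl c ν r a (defect a′ b′) ⟩
        ν * (r * a * defect a′ b′) ∎)
        where
        -- The cofactor of the relation `a′ = q a b′` in the polynomial identity; the other relation
        -- enters by substituting `b = b′ − a′`.
        c = w * q * (q * b′ - q * a′ - 1#) - j
        b≋ : b′ - a′ ≋ b
        b≋ = trans (+-congʳ b′≋) (solve 2 (λ b a → b :+ a :- a := b) refl b a′)
        residue : a′ - q * (a * b′) ≋ 0#
        residue = trans (+-congʳ a′≋) (solve 1 (λ a → a :- a := con (+ 0)) refl _)

      defect-vanishes : (a b : ℕ → Carrier) → (∀ k → b (suc k) ≋ b k + a (suc k)) →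
        (∀ k → a (suc k) ≋ q * (a k * b (suc k))) → defect (a 0) (b 0) ≋ 0# →
        ∀ k → defect (a k) (b k) ≋ 0#
      defect-vanishes a b b-suc a-suc d₀ zero    = d₀
      defect-vanishes a b b-suc a-suc d₀ (suc k) =
        defect-step (b-suc k) (a-suc k) (defect-vanishes a b b-suc a-suc d₀ k)

      -- At `a = 0` the defect is the quadratic `w q² b² − j b + w`. Multiplying it by `4 q² w`
      -- completes the square, and the discriminant `j² − 4 q² w²` is kept as a difference of
      -- squares.
      discriminant : ∀ {a b} → a ≋ 0# → defect a b ≋ 0# →
        (j - 2# * q * q * w * b) * (j - 2# * q * q * w * b) ≋ (j - 2# * q * w) * (j + 2# * q * w)
      discriminant {a} {b} a≋0 d≋0 = begin
        (j - 2# * q * q * w * b) * (j - 2# * q * q * w * b)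
          ≈⟨ solve 5 (λ w j q a b →
               (j :- con (+ 2) :* q :* q :* w :* b) :* (j :- con (+ 2) :* q :* q :* w :* b)
               := (j :- con (+ 2) :* q :* w) :* (j :+ con (+ 2) :* q :* w)
                  :+ con (+ 4) :* q :* q :* w :*
                     ((w :* (con (+ 1) :+ q :* q :* (b :* b) :- q :* a :* (con (+ 1) :+ q :* b)) :- j :* b)
                      :+ w :* q :* (con (+ 1) :+ q :* b) :* a))
               refl w j q a b ⟩
        (j - 2# * q * w) * (j + 2# * q * w)
          + ι (+ 4) * q * q * w * (defect a b + w * q * (1# + q * b) * a)
          ≈⟨ +-congˡ (*-congˡ (+-cong d≋0 (*-congˡ a≋0))) ⟩
        (j - 2# * q * w) * (j + 2# * q * w)
          + ι (+ 4) * q * q * w * (0# + w * q * (1# + q * b) * 0#)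
          ≈⟨ solve 3 (λ u v c → u :+ v :* (con (+ 0) :+ c :* con (+ 0)) := u) refl _ _ _ ⟩
        (j - 2# * q * w) * (j + 2# * q * w) ∎

    -- Sums over Dyck paths

    ∑ : ℕ → (Dyck → Carrier) → Carrier
    ∑ zero    f = f ε
    ∑ (suc d) f = f ε + ∑ d (λ α → ∑ d (λ β → f (ret α β)))

    ∑-cong : ∀ d {f g} → (∀ P → f P ≋ g P) → ∑ d f ≋ ∑ d g
    ∑-cong zero    p = p ε
    ∑-cong (suc d) p = +-cong (p ε) (∑-cong d (λ α → ∑-cong d (λ β → p (ret α β))))

    ∑-+ : ∀ d f g → ∑ d (λ P → f P + g P) ≋ ∑ d f + ∑ d g
    ∑-+ zero    f g = refl
    ∑-+ (suc d) f g = begin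
      f ε + g ε + ∑ d (λ α → ∑ d (λ β → f (ret α β) + g (ret α β)))
        ≈⟨ +-congˡ (trans (∑-cong d (λ α → ∑-+ d _ _)) (∑-+ d _ _)) ⟩
      f ε + g ε + (∑ d (λ α → ∑ d (λ β → f (ret α β))) + ∑ d (λ α → ∑ d (λ β → g (ret α β))))
        ≈⟨ solve 4 (λ a b c d → a :+ b :+ (c :+ d) := a :+ c :+ (b :+ d)) refl _ _ _ _ ⟩
      ∑ (suc d) f + ∑ (suc d) g ∎

    ∑-* : ∀ d c f → ∑ d (λ P → c * f P) ≋ c * ∑ d f
    ∑-* zero    c f = refl
    ∑-* (suc d) c f = trans
      (+-congˡ (trans (∑-cong d (λ α → ∑-* d c _)) (∑-* d c _))) (sym (distribˡ c _ _))

    ∑-zero : ∀ d {f} → (∀ P → f P ≋ 0#) → ∑ d f ≋ 0#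
    ∑-zero d {f} p = begin
      ∑ d f               ≈⟨ ∑-cong d (λ P → trans (p P) (sym (*-zeroˡ _))) ⟩
      ∑ d (λ P → 0# * f P) ≈⟨ ∑-* d 0# f ⟩
      0# * ∑ d f          ≈⟨ *-zeroˡ _ ⟩
      0# ∎

    -- A tree that first appears at depth `suc d` has more than `d` nodes, and its number of nodes
    -- is the semilength.
    ∑-stable : ∀ d f → (∀ P → d ℕ.< semilength P → f P ≋ 0#) → ∑ (suc d) f ≋ ∑ d f
    ∑-stable zero    f p = trans (+-congˡ (p (ret ε ε) (s≤s z≤n)))
      (solve 1 (λ a → a :+ con (+ 0) := a) refl (f ε))
    ∑-stable (suc d) f p = +-congˡ (trans
      -- The depth allowed for β is lowered first, then that for α; one large subtree already makes
      -- `ret α β` large.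
      (∑-cong (suc d) (λ α → ∑-stable d _ (λ β d<β →
        p (ret α β) (s≤s (ℕ.≤-trans d<β (ℕ.m≤n+m _ _))))))
      (∑-stable d _ (λ α d<α → ∑-zero d (λ β →
        p (ret α β) (s≤s (ℕ.≤-trans d<α (ℕ.m≤m+n _ _)))))))

    -- Typical of weights divisible by ν to the semilength. It makes the finite sum `Σᴰ` stand for
    -- the sum over all Dyck paths.
    Small : (Dyck → Carrier) → Set
    Small f = ∀ P → N ℕ.≤ semilength P → f P ≋ 0#

    Σᴰ : (Dyck → Carrier) → Carrier
    Σᴰ = ∑ N

    -- By stability the sum of `f` may be taken one level deeper; after splitting off ε both
    -- subtrees then range over depth `N`, as in `Σᴰ`.
    Σᴰ-ret : ∀ f g h → Small f → (∀ α β → f (ret α β) ≋ ν * (g α * h β)) →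
             Σᴰ f ≋ f ε + ν * (Σᴰ g * Σᴰ h)
    Σᴰ-ret f g h f-small f-ret = begin
      ∑ N f       ≈⟨ ∑-stable N f (λ P N<P → f-small P (ℕ.<⇒≤ N<P)) ⟨
      ∑ (suc N) f ≈⟨ +-congˡ (∑-cong N inner) ⟩
      f ε + ∑ N (λ α → ν * Σᴰ h * g α) ≈⟨ +-congˡ (∑-* N _ g) ⟩
      f ε + ν * Σᴰ h * Σᴰ g
        ≈⟨ +-congˡ (solve 3 (λ ν h g → ν :* h :* g := ν :* (g :* h)) refl ν _ _) ⟩
      f ε + ν * (Σᴰ g * Σᴰ h) ∎
      where
      inner : ∀ α → ∑ N (λ β → f (ret α β)) ≋ ν * Σᴰ h * g α
      inner α = begin
        ∑ N (λ β → f (ret α β))    ≈⟨ ∑-cong N (λ β → trans (f-ret α β) (sym (*-assoc ν _ _))) ⟩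
        ∑ N (λ β → ν * g α * h β)  ≈⟨ ∑-* N (ν * g α) h ⟩
        ν * g α * Σᴰ h
          ≈⟨ solve 3 (λ ν g h → ν :* g :* h := ν :* h :* g) refl ν _ _ ⟩
        ν * Σᴰ h * g α ∎

    𝟏 : Bool → Carrier
    𝟏 b = if b then 1# else 0#

    𝟏-∧ : ∀ a b → 𝟏 (a ∧ b) ≋ 𝟏 a * 𝟏 b
    𝟏-∧ true  b = sym (trans (*-comm _ _) (*1 _))
    𝟏-∧ false b = sym (*-zeroˡ _)

    ∑-ε : ∀ d {f} → (∀ α β → f (ret α β) ≋ 0#) → ∑ d f ≋ f ε
    ∑-ε zero        p = refl
    ∑-ε (suc d) {f} p = trans (+-congˡ (∑-zero d (λ α → ∑-zero d (p α))))
      (solve 1 (λ a → a :+ con (+ 0) := a) refl (f ε))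

    𝟏-atMost-suc : ∀ k P → 𝟏 (atMost (suc k) P) ≋ 𝟏 (atMost k P) + 𝟏 (exactly (suc k) P)
    𝟏-atMost-suc k P with inDh≥ P
    ... | false = solve 0 (con (+ 0) := con (+ 0) :+ con (+ 0)) refl
    ... | true with ℕ.<-cmp (height P) (suc k)
    ...   | tri< (s≤s h≤k) h≢ _ rewrite ≤ᵇ-true h≤k | ≤ᵇ-true (ℕ.m≤n⇒m≤1+n h≤k) | ≡ᵇ-false h≢
            = solve 0 (con (+ 1) := con (+ 1) :+ con (+ 0)) refl
    ...   | tri≈ _ h≡ _ rewrite h≡ | ≤ᵇ-true (ℕ.≤-refl {suc k}) | ≤ᵇ-false (ℕ.n<1+n k) | ≡ᵇ-refl k
            = solve 0 (con (+ 1) := con (+ 0) :+ con (+ 1)) refl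
    ...   | tri> _ h≢ k<h rewrite ≤ᵇ-false k<h | ≤ᵇ-false (ℕ.<⇒≤ k<h) | ≡ᵇ-false h≢
            = solve 0 (con (+ 0) := con (+ 0) :+ con (+ 0)) refl

    𝕀 : Dyck → Carrier
    𝕀 _ = 1#

    -- Weighted generating functions by height

    module Weighted (wt : Dyck → Carrier) (wt-small : Small wt) (wt-ε : wt ε ≋ 1#) where

      -- The statistic `s` is separate from `wt` since it need not be multiplicative along the
      -- decomposition, for example the indicator of a final peak.
      gf : (Dyck → Bool) → (Dyck → Carrier) → Carrier
      gf φ s = Σᴰ (λ P → 𝟏 (φ P) * wt P * s P)

      summand-small : (φ : Dyck → Bool) (s : Dyck → Carrier) → Small (λ P → 𝟏 (φ P) * wt P * s P)
      summand-small φ s P N≤P = trans (*-congʳ (*-congˡ (wt-small P N≤P)))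
        (solve 2 (λ a b → a :* con (+ 0) :* b := con (+ 0)) refl _ _)

      gf-cong : ∀ {φ ψ} s → (∀ P → semilength P ℕ.< N → φ P ≡ ψ P) → gf φ s ≋ gf ψ s
      gf-cong {φ} {ψ} s φ≡ψ = ∑-cong N pointwise
        where
        pointwise : ∀ P → 𝟏 (φ P) * wt P * s P ≋ 𝟏 (ψ P) * wt P * s P
        pointwise P with semilength P ℕ.<? N
        ... | yes P<N = *-congʳ (*-congʳ (reflexive (cong 𝟏 (φ≡ψ P P<N))))
        ... | no  P≮N = trans (summand-small φ s P (ℕ.≮⇒≥ P≮N))
                              (sym (summand-small ψ s P (ℕ.≮⇒≥ P≮N)))

      gf-false : ∀ s → gf (λ _ → false) s ≋ 0#
      gf-false s = ∑-zero N (λ P → solve 2 (λ a b → con (+ 0) :* a :* b := con (+ 0)) refl _ _)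

      gf-linear : ∀ (φ : Dyck → Bool) {s} c₁ (s₁ : Dyck → Carrier) c₂ (s₂ : Dyck → Carrier) →
                  (∀ P → 𝟏 (φ P) * s P ≋ 𝟏 (φ P) * (c₁ * s₁ P + c₂ * s₂ P)) →
                  gf φ s ≋ c₁ * gf φ s₁ + c₂ * gf φ s₂
      gf-linear φ {s} c₁ s₁ c₂ s₂ s≋ = begin
        gf φ s ≈⟨ ∑-cong N (λ P → pointwise (s≋ P)) ⟩
        Σᴰ (λ P → c₁ * (𝟏 (φ P) * wt P * s₁ P) + c₂ * (𝟏 (φ P) * wt P * s₂ P)) ≈⟨ ∑-+ N _ _ ⟩
        _ ≈⟨ +-cong (∑-* N c₁ _) (∑-* N c₂ _) ⟩
        c₁ * gf φ s₁ + c₂ * gf φ s₂ ∎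
        where
        pointwise : ∀ {i w a b c} → i * a ≋ i * (c₁ * b + c₂ * c) →
                    i * w * a ≋ c₁ * (i * w * b) + c₂ * (i * w * c)
        pointwise {i} {w} {a} {b} {c} p = begin
          i * w * a ≈⟨ solve 3 (λ i w a → i :* w :* a := w :* (i :* a)) refl i w a ⟩
          w * (i * a) ≈⟨ *-congˡ p ⟩
          w * (i * (c₁ * b + c₂ * c))
            ≈⟨ solve 6 (λ w i c₁ b c₂ c → w :* (i :* (c₁ :* b :+ c₂ :* c))
                 := c₁ :* (i :* w :* b) :+ c₂ :* (i :* w :* c)) refl w i c₁ b c₂ c ⟩
          c₁ * (i * w * b) + c₂ * (i * w * c) ∎

      A B : (Dyck → Carrier) → ℕ → Carrier
      A s k = gf (exactly k) s
      B s k = gf (atMost k) s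

      -- The height is at most the semilength, so a path of height `N` or more has zero weight. With
      -- `B-total`, this is how the limit of the recurrence is attained.
      A-vanishes : ∀ s {k} → N ℕ.≤ k → A s k ≋ 0#
      A-vanishes s {k} N≤k = trans (gf-cong s too-high) (gf-false s)
        where
        too-high : ∀ P → semilength P ℕ.< N → exactly k P ≡ false
        too-high P P<N rewrite ≡ᵇ-false
          (ℕ.<⇒≢ (ℕ.<-≤-trans (ℕ.≤-<-trans (height≤semilength P) P<N) N≤k)) = ∧-zeroʳ _

      B-total : ∀ s {k} → N ℕ.≤ k → B s k ≋ gf inDh≥ s
      B-total s {k} N≤k = gf-cong s low
        where
        low : ∀ P → semilength P ℕ.< N → atMost k P ≡ inDh≥ P
        low P P<N rewrite ≤ᵇ-true
          (ℕ.≤-trans (height≤semilength P) (ℕ.≤-trans (ℕ.<⇒≤ P<N) N≤k)) = ∧-identityʳ _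

      B-suc : ∀ s k → B s (suc k) ≋ B s k + A s (suc k)
      B-suc s k = trans (∑-cong N (λ P → trans (*-congʳ (*-congʳ (𝟏-atMost-suc k P)))
        (solve 4 (λ a b w s → (a :+ b) :* w :* s := a :* w :* s :+ b :* w :* s) refl _ _ _ _)))
        (∑-+ N _ _)

      summand-ε : (s : Dyck → Carrier) → 1# * wt ε * s ε ≋ s ε
      summand-ε s = trans (*-congʳ (*-congˡ wt-ε))
        (solve 1 (λ a → con (+ 1) :* con (+ 1) :* a := a) refl _)

      A-zero : ∀ s → A s 0 ≋ s ε
      A-zero s = trans (∑-ε N (λ α β → trans (*-congʳ (*-congʳ (reflexive (cong 𝟏 (exactly-0-ret α β)))))
        (solve 2 (λ a b → con (+ 0) :* a :* b := con (+ 0)) refl _ _))) (summand-ε s)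

      B-zero : ∀ s → B s 0 ≋ s ε
      B-zero s = trans (∑-ε N (λ α β → trans (*-congʳ (*-congʳ (reflexive (cong 𝟏 (positive α β)))))
        (solve 2 (λ a b → con (+ 0) :* a :* b := con (+ 0)) refl _ _))) (summand-ε s)
        where
        positive : ∀ α β → atMost 0 (ret α β) ≡ false
        positive α β rewrite ≤ᵇ-false (height-ret>0 α β) = ∧-zeroʳ _

      B-isEmpty : ∀ k → B (λ P → 𝟏 (isEmpty P)) k ≋ 1#
      B-isEmpty k = trans (∑-ε N (λ α β → *-zeroʳ _)) (summand-ε (λ P → 𝟏 (isEmpty P)))

      module Crossing (cr : Dyck → Dyck → Carrier)
        (wt-ret : ∀ α β → wt (ret α β) ≋ ν * (wt α * wt β * cr α β)) where

        -- After `exactly-ret` only the crossing weight and `s` still couple α with β. `factor`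
        -- separates them, and may assume that α has height `k`, which decides whether α is empty.
        A-suc : ∀ {s : Dyck → Carrier} (l m : Dyck → Carrier) k →
          (∀ α β → 𝟏 (exactly k α) * (cr α β * s (ret α β)) ≋ 𝟏 (exactly k α) * (l α * m β)) →
          A s (suc k) ≋ ν * (A l k * B m (suc k))
        A-suc {s} l m k factor = trans
          (Σᴰ-ret _ _ _ (summand-small (exactly (suc k)) s) pointwise)
          -- The term of ε is zero, since its height is not `suc k`.
          (solve 3 (λ a b c → con (+ 0) :* a :* b :+ c := c) refl _ _ _)
          where
          pointwise : ∀ α β → 𝟏 (exactly (suc k) (ret α β)) * wt (ret α β) * s (ret α β) ≋
            ν * (𝟏 (exactly k α) * wt α * l α * (𝟏 (atMost (suc k) β) * wt β * m β))
          pointwise α β = begin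
            𝟏 (exactly (suc k) (ret α β)) * wt (ret α β) * s (ret α β)
              ≈⟨ *-congʳ (*-cong (trans (reflexive (cong 𝟏 (exactly-ret k α β))) (𝟏-∧ _ _)) (wt-ret α β)) ⟩
            𝟏 (exactly k α) * 𝟏 (atMost (suc k) β) * (ν * (wt α * wt β * cr α β)) * s (ret α β)
              ≈⟨ solve 7 (λ e t ν a b c s → e :* t :* (ν :* (a :* b :* c)) :* s
                   := ν :* (t :* a :* b) :* (e :* (c :* s))) refl _ _ _ _ _ _ _ ⟩
            ν * (𝟏 (atMost (suc k) β) * wt α * wt β) * (𝟏 (exactly k α) * (cr α β * s (ret α β)))
              ≈⟨ *-congˡ (factor α β) ⟩
            ν * (𝟏 (atMost (suc k) β) * wt α * wt β) * (𝟏 (exactly k α) * (l α * m β))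
              ≈⟨ solve 7 (λ e t ν a b l m → ν :* (t :* a :* b) :* (e :* (l :* m))
                   := ν :* (e :* a :* l :* (t :* b :* m))) refl _ _ _ _ _ _ _ ⟩
            ν * (𝟏 (exactly k α) * wt α * l α * (𝟏 (atMost (suc k) β) * wt β * m β)) ∎

      δ∅ δ∧ : Dyck → Carrier
      δ∅ P = 𝟏 (isEmpty P)
      δ∧ P = 𝟏 (endsUD P)

      -- The common shape of UDU and DDU: a factor u or v, according to whether α
      -- is empty, whenever β is nonempty.
      module EmptinessCrossing (u v : Carrier)
        (wt-ret : ∀ α β → wt (ret α β) ≋
          ν * (wt α * wt β * emptinessFactor u v α β)) where

        open Crossing _ wt-ret

        -- At a fixed height of α the crossing factor is a constant `t` for every nonempty β. Using
        -- `t` for the empty β as well is corrected by `1 − t`.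
        A-suc-tail : ∀ k t →
          (∀ α → 𝟏 (exactly k α) * (if isEmpty α then u else v) ≋ 𝟏 (exactly k α) * t) →
          A 𝕀 (suc k) ≋ ν * (A 𝕀 k * (t * B 𝕀 (suc k) + (1# - t)))
        A-suc-tail k t on-exactly = begin
          A 𝕀 (suc k) ≈⟨ A-suc 𝕀 tail k factor ⟩
          ν * (A 𝕀 k * B tail (suc k))
            ≈⟨ *-congˡ (*-congˡ (gf-linear (atMost (suc k)) t 𝕀 (1# - t) δ∅ (λ P → *-congˡ (tail≋ P)))) ⟩
          ν * (A 𝕀 k * (t * B 𝕀 (suc k) + (1# - t) * B δ∅ (suc k)))
            ≈⟨ *-congˡ (*-congˡ (+-congˡ (trans (*-congˡ (B-isEmpty (suc k))) (*1 _)))) ⟩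
          ν * (A 𝕀 k * (t * B 𝕀 (suc k) + (1# - t))) ∎
          where
          tail : Dyck → Carrier
          tail β = if isEmpty β then 1# else t
          tail≋ : ∀ P → tail P ≋ t * 𝕀 P + (1# - t) * δ∅ P
          tail≋ ε         = solve 1 (λ t → con (+ 1) := t :* con (+ 1) :+ (con (+ 1) :- t) :* con (+ 1)) refl t
          tail≋ (ret _ _) = solve 1 (λ t → t := t :* con (+ 1) :+ (con (+ 1) :- t) :* con (+ 0)) refl t
          factor : ∀ α β →
            𝟏 (exactly k α) * (emptinessFactor u v α β * 𝕀 (ret α β)) ≋
            𝟏 (exactly k α) * (𝕀 α * tail β)
          factor α ε         = refl
          factor α (ret _ _) = trans (*-congˡ (*1 _)) (trans (on-exactly α)
            (*-congˡ (trans (sym (*1 t)) (*-comm _ _))))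

        A-one : A 𝕀 1 ≋ ν * (u * B 𝕀 1 + (1# - u))
        A-one = trans (A-suc-tail 0 u on-exactly) (trans (*-congˡ (*-congʳ (A-zero 𝕀)))
          (solve 2 (λ ν a → ν :* (con (+ 1) :* a) := ν :* a) refl ν _))
          where
          on-exactly : ∀ α → 𝟏 (exactly 0 α) * (if isEmpty α then u else v) ≋ 𝟏 (exactly 0 α) * u
          on-exactly ε         = refl
          on-exactly (ret α β) rewrite exactly-0-ret α β = trans (*-zeroˡ v) (sym (*-zeroˡ u))

        A-suc-suc : ∀ k → A 𝕀 (2 ℕ.+ k) ≋ ν * (A 𝕀 (suc k) * (v * B 𝕀 (2 ℕ.+ k) + (1# - v)))
        A-suc-suc k = A-suc-tail (suc k) v on-exactly
          where
          on-exactly : ∀ α → 𝟏 (exactly (suc k) α) * (if isEmpty α then u else v) ≋ 𝟏 (exactly (suc k) α) * v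
          on-exactly ε         = trans (*-zeroˡ u) (sym (*-zeroˡ v))
          on-exactly (ret _ _) = refl

        -- From `(1 − ν u) A 𝕀 1 = ν` comes `b 0 = 1 + v A 𝕀 1 = w / (1 − ν u)`. With
        -- `a 0 = b 0 − 1` the numerator of the invariant is `1 + ν + (ν² − ν) b 0`, and `j` is this
        -- times `1 − ν u`.
        w j : Carrier
        w = 1# - ν * u + ν * v
        j = (1# + ν * ν) * (1# - ν * u) + (ν * ν - ν) * (ν * v)

        open HeightRecurrence 1# w j

        -- The sequences start at height 1, because the step from height 0 has the factor `u`. The
        -- affine substitution absorbs the correction `1 − v`.
        a b : ℕ → Carrier
        a k = v * A 𝕀 (suc k)
        b k = v * B 𝕀 (suc k) + (1# - v)

        b-suc : ∀ k → b (suc k) ≋ b k + a (suc k)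
        b-suc k = trans (+-congʳ (*-congˡ (B-suc 𝕀 (suc k))))
          (solve 3 (λ v b a → v :* (b :+ a) :+ (con (+ 1) :- v) := v :* b :+ (con (+ 1) :- v) :+ v :* a)
            refl v _ _)

        a-suc : ∀ k → a (suc k) ≋ q * (a k * b (suc k))
        a-suc k = trans (*-congˡ (A-suc-suc k))
          (solve 4 (λ v ν a b → v :* (ν :* (a :* b)) := ν :* con (+ 1) :* (v :* a :* b)) refl v ν _ _)

        B-one : B 𝕀 1 ≋ 1# + A 𝕀 1
        B-one = trans (B-suc 𝕀 0) (+-congʳ (B-zero 𝕀))

        A-one-residue : ν - (1# - ν * u) * A 𝕀 1 ≋ 0#
        A-one-residue = begin
          ν - (1# - ν * u) * A 𝕀 1
            ≈⟨ solve 3 (λ ν u a → ν :- (con (+ 1) :- ν :* u) :* a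
                 := ν :* (u :* (con (+ 1) :+ a) :+ (con (+ 1) :- u)) :- a) refl ν u _ ⟩
          ν * (u * (1# + A 𝕀 1) + (1# - u)) - A 𝕀 1
            ≈⟨ +-congʳ (*-congˡ (+-congʳ (*-congˡ B-one))) ⟨
          ν * (u * B 𝕀 1 + (1# - u)) - A 𝕀 1 ≈⟨ +-congʳ A-one ⟨
          A 𝕀 1 - A 𝕀 1 ≈⟨ solve 1 (λ a → a :- a := con (+ 0)) refl _ ⟩
          0# ∎

        -- The defect is `(1 + ν) v` times the linear equation for `A 𝕀 1`, so no division by
        -- `1 − ν u` is made.
        defect₀ : defect (a 0) (b 0) ≋ 0#
        defect₀ = begin
          defect (a 0) (b 0) ≈⟨ defect-congʳ (+-congʳ (*-congˡ B-one)) ⟩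
          defect (v * A 𝕀 1) (v * (1# + A 𝕀 1) + (1# - v))
            ≈⟨ solve 4 (λ ν u v a →
                 let q = ν :* con (+ 1)
                     b = v :* (con (+ 1) :+ a) :+ (con (+ 1) :- v)
                     w = con (+ 1) :- ν :* u :+ ν :* v
                     j = (con (+ 1) :+ ν :* ν) :* (con (+ 1) :- ν :* u) :+ (ν :* ν :- ν) :* (ν :* v)
                 in w :* (con (+ 1) :+ q :* q :* (b :* b) :- q :* (v :* a) :* (con (+ 1) :+ q :* b)) :- j :* b
                    := (con (+ 1) :+ ν) :* v :* (ν :- (con (+ 1) :- ν :* u) :* a)) refl ν u v _ ⟩
          (1# + ν) * v * (ν - (1# - ν * u) * A 𝕀 1) ≈⟨ *-congˡ A-one-residue ⟩
          (1# + ν) * v * 0# ≈⟨ *-zeroʳ _ ⟩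
          0# ∎

        root disc : Carrier
        root = j - 2# * q * q * w * (v * gf inDh≥ 𝕀 + (1# - v))
        disc = (j - 2# * q * w) * (j + 2# * q * w)

        root² : root * root ≋ disc
        root² = trans (*-cong G≋ G≋)
          -- Index `N` of the shifted sequences is height `suc N`, where `A` vanishes and `B` is the
          -- total.
          (discriminant (trans (*-congˡ (A-vanishes 𝕀 (ℕ.n≤1+n N))) (*-zeroʳ v))
            (defect-vanishes a b b-suc a-suc defect₀ N))
          where
          G≋ = +-congˡ (-‿cong (*-congˡ (+-congʳ (*-congˡ (sym (B-total 𝕀 (ℕ.n≤1+n N)))))))

      -- The common shape of UDD and DDD: a factor s or t, according to whether the
      -- nonempty path α ends with a peak.
      module PeakCrossing (s t : Carrier)
        (wt-ret : ∀ α β → wt (ret α β) ≋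
          ν * (wt α * wt β * peakFactor s t α)) where

        open Crossing _ wt-ret

        -- `peakFactor` written linearly in the indicator of a final peak. At ε the two need not
        -- agree, so it serves only for α of positive height.
        side : Dyck → Carrier
        side α = t * 𝕀 α + (s - t) * δ∧ α

        side-ret : ∀ α β → (if endsUD (ret α β) then s else t) ≋ side (ret α β)
        side-ret α β with endsUD (ret α β)
        ... | true  = solve 2 (λ s t → s := t :* con (+ 1) :+ (s :- t) :* con (+ 1)) refl s t
        ... | false = solve 2 (λ s t → t := t :* con (+ 1) :+ (s :- t) :* con (+ 0)) refl s t

        A-side : ∀ k → A side k ≋ t * A 𝕀 k + (s - t) * A δ∧ k
        A-side k = gf-linear (exactly k) t 𝕀 (s - t) δ∧ (λ _ → refl)

        A-one : A 𝕀 1 ≋ ν * B 𝕀 1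
        A-one = trans (A-suc 𝕀 𝕀 0 factor) (trans (*-congˡ (*-congʳ (A-zero 𝕀)))
          (solve 2 (λ ν a → ν :* (con (+ 1) :* a) := ν :* a) refl ν _))
          where
          factor : ∀ α β → 𝟏 (exactly 0 α) * (peakFactor s t α * 𝕀 (ret α β)) ≋
                           𝟏 (exactly 0 α) * (𝕀 α * 𝕀 β)
          factor ε         β = refl
          factor (ret α γ) β rewrite exactly-0-ret α γ = trans (*-zeroˡ _) (sym (*-zeroˡ _))

        A-suc-suc : ∀ k → A 𝕀 (2 ℕ.+ k) ≋ ν * (A side (suc k) * B 𝕀 (2 ℕ.+ k))
        A-suc-suc k = A-suc side 𝕀 (suc k) factor
          where
          factor : ∀ α β → 𝟏 (exactly (suc k) α) * (peakFactor s t α * 𝕀 (ret α β)) ≋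
                           𝟏 (exactly (suc k) α) * (side α * 𝕀 β)
          factor ε         β = trans (*-zeroˡ _) (sym (*-zeroˡ _))
          factor (ret α γ) β = *-congˡ (*-congʳ (side-ret α γ))

        -- With α empty, `ret α β` ends with a peak when β is empty or itself ends with one.
        peaks-one : A δ∧ 1 ≋ ν * (1# + B δ∧ 1)
        peaks-one = begin
          A δ∧ 1 ≈⟨ A-suc 𝕀 last 0 factor ⟩
          ν * (A 𝕀 0 * B last 1)
            ≈⟨ *-congˡ (*-cong (A-zero 𝕀) (gf-linear (atMost 1) 1# δ∅ 1# δ∧ (λ _ → refl))) ⟩
          ν * (1# * (1# * B δ∅ 1 + 1# * B δ∧ 1)) ≈⟨ *-congˡ (*-congˡ (+-congʳ (*-congˡ (B-isEmpty 1)))) ⟩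
          ν * (1# * (1# * 1# + 1# * B δ∧ 1))
            ≈⟨ solve 2 (λ ν e → ν :* (con (+ 1) :* (con (+ 1) :* con (+ 1) :+ con (+ 1) :* e))
                 := ν :* (con (+ 1) :+ e)) refl ν _ ⟩
          ν * (1# + B δ∧ 1) ∎
          where
          last : Dyck → Carrier
          last β = 1# * δ∅ β + 1# * δ∧ β
          factor : ∀ α β → 𝟏 (exactly 0 α) *
            (peakFactor s t α * δ∧ (ret α β)) ≋
            𝟏 (exactly 0 α) * (𝕀 α * last β)
          factor ε         ε         = solve 0
            (con (+ 1) :* (con (+ 1) :* con (+ 1))
              := con (+ 1) :* (con (+ 1) :* (con (+ 1) :* con (+ 1) :+ con (+ 1) :* con (+ 0)))) refl
          factor ε         (ret β γ) = solve 1 (λ e → con (+ 1) :* (con (+ 1) :* e)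
              := con (+ 1) :* (con (+ 1) :* (con (+ 1) :* con (+ 0) :+ con (+ 1) :* e))) refl _
          factor (ret α γ) β rewrite exactly-0-ret α γ = trans (*-zeroˡ _) (sym (*-zeroˡ _))

        -- With α nonempty, the `D` after α follows another `D`, so a final peak must lie in β.
        peaks-suc-suc : ∀ k → A δ∧ (2 ℕ.+ k) ≋ ν * (A side (suc k) * B δ∧ (2 ℕ.+ k))
        peaks-suc-suc k = A-suc side δ∧ (suc k) factor
          where
          factor : ∀ α β → 𝟏 (exactly (suc k) α) *
            (peakFactor s t α * δ∧ (ret α β)) ≋
            𝟏 (exactly (suc k) α) * (side α * δ∧ β)
          factor ε         β         = trans (*-zeroˡ _) (sym (*-zeroˡ _))
          factor (ret α γ) ε         = *-congˡ (trans (*-zeroʳ _) (sym (*-zeroʳ _)))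
          factor (ret α γ) (ret _ _) = *-congˡ (*-congʳ (side-ret α γ))

        -- Deleting the final peak is a bijection onto the paths of height at most k + 1.
        B-peaks : ∀ k → B δ∧ (suc k) ≋ ν * B 𝕀 (suc k)
        -- In place of the bijection: splitting off the paths of maximal height gives one linear
        -- equation satisfied by both sides, with a unique solution by nilpotency.
        B-peaks zero = fixpoint-unique 1# (begin
          B δ∧ 1                   ≈⟨ B-suc δ∧ 0 ⟩
          B δ∧ 0 + A δ∧ 1          ≈⟨ +-cong (B-zero δ∧) peaks-one ⟩
          0# + ν * (1# + B δ∧ 1)
            ≈⟨ solve 2 (λ ν e → con (+ 0) :+ ν :* (con (+ 1) :+ e) := ν :+ ν :* (con (+ 1) :* e)) refl ν _ ⟩
          ν + ν * (1# * B δ∧ 1)    ∎) (begin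
          ν * B 𝕀 1                ≈⟨ *-congˡ (trans (B-suc 𝕀 0) (+-cong (B-zero 𝕀) A-one)) ⟩
          ν * (1# + ν * B 𝕀 1)
            ≈⟨ solve 2 (λ ν b → ν :* (con (+ 1) :+ ν :* b) := ν :+ ν :* (con (+ 1) :* (ν :* b))) refl ν _ ⟩
          ν + ν * (1# * (ν * B 𝕀 1)) ∎)
        B-peaks (suc k) = fixpoint-unique (A side (suc k)) (begin
          B δ∧ (2 ℕ.+ k)                         ≈⟨ B-suc δ∧ (suc k) ⟩
          B δ∧ (suc k) + A δ∧ (2 ℕ.+ k)          ≈⟨ +-cong (B-peaks k) (peaks-suc-suc k) ⟩
          ν * B 𝕀 (suc k) + ν * (A side (suc k) * B δ∧ (2 ℕ.+ k)) ∎) (begin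
          ν * B 𝕀 (2 ℕ.+ k)                      ≈⟨ *-congˡ (trans (B-suc 𝕀 (suc k)) (+-congˡ (A-suc-suc k))) ⟩
          ν * (B 𝕀 (suc k) + ν * (A side (suc k) * B 𝕀 (2 ℕ.+ k)))
            ≈⟨ solve 4 (λ ν b a b′ → ν :* (b :+ ν :* (a :* b′)) := ν :* b :+ ν :* (a :* (ν :* b′))) refl ν _ _ _ ⟩
          ν * B 𝕀 (suc k) + ν * (A side (suc k) * (ν * B 𝕀 (2 ℕ.+ k))) ∎)

        -- Paths of height 1 are repetitions of UD. Here this follows from `B-peaks 0`, as ε has no
        -- final peak.
        A-peaks-one : A δ∧ 1 ≋ A 𝕀 1
        A-peaks-one = begin
          A δ∧ 1          ≈⟨ trans (sym (*1 _)) (*-comm _ _) ⟩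
          1# * A δ∧ 1     ≈⟨ solve 1 (λ e → con (+ 1) :* e := con (+ 0) :+ e) refl _ ⟩
          0# + A δ∧ 1     ≈⟨ +-congʳ (B-zero δ∧) ⟨
          B δ∧ 0 + A δ∧ 1 ≈⟨ B-suc δ∧ 0 ⟨
          B δ∧ 1          ≈⟨ B-peaks 0 ⟩
          ν * B 𝕀 1       ≈⟨ A-one ⟨
          A 𝕀 1 ∎

        -- The difference of two consecutive cases of `B-peaks`, which start at height 1; hence the
        -- restriction to height 2 and above.
        A-peaks-suc-suc : ∀ k → A δ∧ (2 ℕ.+ k) ≋ ν * A 𝕀 (2 ℕ.+ k)
        A-peaks-suc-suc k = begin
          A δ∧ (2 ℕ.+ k)
            ≈⟨ increment (B-suc δ∧ (suc k)) ⟩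
          B δ∧ (2 ℕ.+ k) - B δ∧ (suc k)
            ≈⟨ +-cong (B-peaks (suc k)) (-‿cong (B-peaks k)) ⟩
          ν * B 𝕀 (2 ℕ.+ k) - ν * B 𝕀 (suc k)
            ≈⟨ solve 3 (λ ν b′ b → ν :* b′ :- ν :* b := ν :* (b′ :- b)) refl ν _ _ ⟩
          ν * (B 𝕀 (2 ℕ.+ k) - B 𝕀 (suc k))
            ≈⟨ *-congˡ (increment (B-suc 𝕀 (suc k))) ⟨
          ν * A 𝕀 (2 ℕ.+ k) ∎
          where
          increment : ∀ {a b b′} → b′ ≋ b + a → a ≋ b′ - b
          increment {a} {b} p = trans (solve 2 (λ a b → a := b :+ a :- b) refl a b) (+-congʳ (sym p))

        A-two : A 𝕀 2 ≋ ν * (s * A 𝕀 1 * B 𝕀 2)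
        A-two = trans (A-suc-suc 0) (*-congˡ (*-congʳ
          (trans (A-side 1) (trans (+-congˡ (*-congˡ A-peaks-one))
            (solve 3 (λ s t a → t :* a :+ (s :- t) :* a := s :* a) refl s t _)))))

        -- `r` is the mean of `s` and `t` weighted by the share ν of paths ending with a peak. As
        -- `1 / b₂ = 1 − ν − s ν²` and `(1 − ν) a₂ = s ν² b₂`, the invariant is
        -- `1 / b₂ + q (q − s ν²) / (1 − ν)`, where `q − s ν² = ν t (1 − ν)`; so `w = 1`.
        r j : Carrier
        r = t + (s - t) * ν
        j = 1# - ν - s * ν * ν + ν * r * (ν * t)

        open HeightRecurrence r 1# j

        a-suc : ∀ k → A 𝕀 (3 ℕ.+ k) ≋ q * (A 𝕀 (2 ℕ.+ k) * B 𝕀 (3 ℕ.+ k))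
        a-suc k = trans (A-suc-suc (suc k)) (trans (*-congˡ (*-congʳ
          (trans (A-side (2 ℕ.+ k)) (+-congˡ (*-congˡ (A-peaks-suc-suc k))))))
          (solve 5 (λ ν s t a b → ν :* ((t :* a :+ (s :- t) :* (ν :* a)) :* b)
            := ν :* (t :+ (s :- t) :* ν) :* (a :* b)) refl ν s t _ _))

        private
          b₁ a₂ b₂ σ τ : Carrier
          b₁ = B 𝕀 1
          a₂ = A 𝕀 2
          b₂ = B 𝕀 2
          σ = (1# - ν) * a₂ - s * ν * ν * b₂
          τ = (1# - ν - s * ν * ν) * b₂ - 1#

        b₁-residue : (1# - ν) * b₁ - 1# ≋ 0#
        b₁-residue = begin
          (1# - ν) * b₁ - 1#
            ≈⟨ solve 2 (λ ν b → (con (+ 1) :- ν) :* b :- con (+ 1) := b :- (con (+ 1) :+ ν :* b)) refl ν _ ⟩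
          b₁ - (1# + ν * b₁)
            ≈⟨ +-congʳ (trans (B-suc 𝕀 0) (+-cong (B-zero 𝕀) A-one)) ⟩
          1# + ν * b₁ - (1# + ν * b₁) ≈⟨ solve 1 (λ a → a :- a := con (+ 0)) refl _ ⟩
          0# ∎

        σ≋0 : σ ≋ 0#
        σ≋0 = begin
          (1# - ν) * a₂ - s * ν * ν * b₂
            ≈⟨ +-congʳ (*-congˡ (trans A-two (*-congˡ (*-congʳ (*-congˡ A-one))))) ⟩
          (1# - ν) * (ν * (s * (ν * b₁) * b₂)) - s * ν * ν * b₂
            ≈⟨ solve 4 (λ ν s b₁ b₂ →
                 (con (+ 1) :- ν) :* (ν :* (s :* (ν :* b₁) :* b₂)) :- s :* ν :* ν :* b₂
                 := s :* ν :* ν :* b₂ :* ((con (+ 1) :- ν) :* b₁ :- con (+ 1))) refl ν s b₁ b₂ ⟩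
          s * ν * ν * b₂ * ((1# - ν) * b₁ - 1#) ≈⟨ *-congˡ b₁-residue ⟩
          s * ν * ν * b₂ * 0# ≈⟨ *-zeroʳ _ ⟩
          0# ∎

        τ≋0 : τ ≋ 0#
        τ≋0 = begin
          (1# - ν - s * ν * ν) * b₂ - 1#
            ≈⟨ solve 3 (λ ν s b → (con (+ 1) :- ν :- s :* ν :* ν) :* b :- con (+ 1)
                 := (con (+ 1) :- ν) :* b :- con (+ 1) :- s :* ν :* ν :* b) refl ν s b₂ ⟩
          (1# - ν) * b₂ - 1# - s * ν * ν * b₂
            ≈⟨ +-congʳ (+-congʳ (*-congˡ (B-suc 𝕀 1))) ⟩
          (1# - ν) * (b₁ + a₂) - 1# - s * ν * ν * b₂
            ≈⟨ solve 4 (λ ν b a c → (con (+ 1) :- ν) :* (b :+ a) :- con (+ 1) :- c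
                 := ((con (+ 1) :- ν) :* b :- con (+ 1)) :+ ((con (+ 1) :- ν) :* a :- c)) refl ν b₁ a₂ _ ⟩
          ((1# - ν) * b₁ - 1#) + σ ≈⟨ +-cong b₁-residue σ≋0 ⟩
          0# + 0# ≈⟨ solve 0 (con (+ 0) :+ con (+ 0) := con (+ 0)) refl ⟩
          0# ∎

        -- `1 − ν` times the defect is a combination of `τ` and `σ`; `nilpotent-cancel` with `g = 1`
        -- removes the factor.
        defect₀ : defect a₂ b₂ ≋ 0#
        defect₀ = nilpotent-cancel 1# (begin
          defect a₂ b₂
            ≈⟨ solve 5 (λ ν s t a b →
                 let q = ν :* (t :+ (s :- t) :* ν)
                     j = con (+ 1) :- ν :- s :* ν :* ν :+ q :* (ν :* t)
                     d = con (+ 1) :* (con (+ 1) :+ q :* q :* (b :* b) :- q :* a :* (con (+ 1) :+ q :* b)) :- j :* b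
                 in d := ν :* (con (+ 1) :* d)
                      :+ (q :* q :* b :- (con (+ 1) :- ν)) :* ((con (+ 1) :- ν :- s :* ν :* ν) :* b :- con (+ 1))
                      :- q :* (con (+ 1) :+ q :* b) :* ((con (+ 1) :- ν) :* a :- s :* ν :* ν :* b))
                 refl ν s t a₂ b₂ ⟩
          ν * (1# * defect a₂ b₂) + (q * q * b₂ - (1# - ν)) * τ - q * (1# + q * b₂) * σ
            ≈⟨ +-cong (+-congˡ (*-congˡ τ≋0)) (-‿cong (*-congˡ σ≋0)) ⟩
          ν * (1# * defect a₂ b₂) + (q * q * b₂ - (1# - ν)) * 0# - q * (1# + q * b₂) * 0#
            ≈⟨ solve 3 (λ d u v → d :+ u :* con (+ 0) :- v :* con (+ 0) := d) refl _ _ _ ⟩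
          ν * (1# * defect a₂ b₂) ∎)

        root disc : Carrier
        root = j - 2# * q * q * 1# * gf inDh≥ 𝕀
        disc = (j - 2# * q * 1#) * (j + 2# * q * 1#)

        root² : root * root ≋ disc
        root² = trans (*-cong G≋ G≋)
          (discriminant (A-vanishes 𝕀 N≤) (defect-vanishes (λ k → A 𝕀 (2 ℕ.+ k)) (λ k → B 𝕀 (2 ℕ.+ k))
            (λ k → B-suc 𝕀 (2 ℕ.+ k)) a-suc defect₀ N))
          where
          N≤ : N ℕ.≤ 2 ℕ.+ N
          N≤ = ℕ.m≤n+m N 2
          G≋ = +-congˡ (-‿cong (*-congˡ (sym (B-total 𝕀 N≤))))

open ≡ using (refl; sym; trans; module ≡-Reasoning)

-- The ring of power series in x and y

sumTo-suc : ∀ n f → sumTo (suc n) f ≡ f 0 ℤ.+ sumTo n (f ∘ suc)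
sumTo-suc zero    f = refl
sumTo-suc (suc n) f =
  trans (cong (ℤ._+ f (suc (suc n))) (sumTo-suc n f)) (ℤ.+-assoc (f 0) _ _)

-- Series in x whose coefficients are series in y, modulo x^(N+1) and y^(K+1).
module TruncatedPS (N K : ℕ) where

  module Y  = TruncatedSeries ℤ.+-*-commutativeRing K
  module XY = TruncatedSeries Y.commutativeRing N

  sumTo-Y⋆ : ∀ f g k → sumTo k (λ j → f j ℤ.* g (k ∸ j)) ≡ (f Y.⋆ g) k
  sumTo-Y⋆ f g zero    = refl
  sumTo-Y⋆ f g (suc k) =
    trans (sumTo-suc k _) (cong (ℤ._+_ (f 0 ℤ.* g (suc k))) (sumTo-Y⋆ (f ∘ suc) g k))

  ⊛≡⋆ : ∀ f g n k → (f ⊛ g) n k ≡ (f XY.⋆ g) n k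
  ⊛≡⋆ f g zero    k = sumTo-Y⋆ (f 0) (g 0) k
  ⊛≡⋆ f g (suc n) k = trans (sumTo-suc n _)
    (cong₂ ℤ._+_ (sumTo-Y⋆ (f 0) (g (suc n)) k) (⊛≡⋆ (f ∘ suc) g n k))

  infix 4 _≈ᴺ_
  _≈ᴺ_ : PS → PS → Set
  f ≈ᴺ g = ∀ {n} → n ℕ.≤ N → ∀ {k} → k ℕ.≤ K → f n k ≡ g n k

  rawRing : RawRing 0ℓ 0ℓ
  rawRing = record
    { Carrier = PS ; _≈_ = _≈ᴺ_ ; _+_ = _⊕_ ; _*_ = _⊛_
    ; -_ = λ f n k → ℤ.- f n k ; 0# = cst (+ 0) ; 1# = cst (+ 1) }

  cst0 : ∀ n k → cst (+ 0) n k ≡ + 0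
  cst0 zero    zero    = refl
  cst0 zero    (suc k) = refl
  cst0 (suc n) k       = refl

  cst1 : ∀ n k → cst (+ 1) n k ≡ XY.one n k
  cst1 zero    zero    = refl
  cst1 zero    (suc k) = refl
  cst1 (suc n) k       = refl

  -- Pulls the ring laws of the nested series back along the identity to `PS` with its own product
  -- and constants.
  id-isRingMonomorphism :
    IsRingMonomorphism rawRing (CommutativeRing.rawRing XY.commutativeRing) id
  id-isRingMonomorphism = record
    { isRingHomomorphism = record
      { isSemiringHomomorphism = record
        { isNearSemiringHomomorphism = record
          { +-isMonoidHomomorphism = record
            { isMagmaHomomorphism = record
              { isRelHomomorphism = record { cong = id }
              ; homo = λ _ _ _ _ → refl }
            ; ε-homo = λ {n} _ {k} _ → cst0 n k }
          ; *-homo = λ f g {n} _ {k} _ → ⊛≡⋆ f g n k }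
        ; 1#-homo = λ {n} _ {k} _ → cst1 n k }
      ; -‿homo = λ _ _ _ → refl }
    ; injective = id }

  commutativeRing : CommutativeRing 0ℓ 0ℓ
  commutativeRing = record
    { isCommutativeRing = RingMonomorphism.isCommutativeRing id-isRingMonomorphism
        (CommutativeRing.isCommutativeRing XY.commutativeRing) }

-- Products with constants and monomials

sumTo-zero : ∀ n {f} → (∀ i → f i ≡ + 0) → sumTo n f ≡ + 0
sumTo-zero zero    p = p 0
sumTo-zero (suc n) p = cong₂ ℤ._+_ (sumTo-zero n p) (p (suc n))

sumTo-head : ∀ n {f} → (∀ i → f (suc i) ≡ + 0) → sumTo n f ≡ f 0
sumTo-head zero    p = refl
sumTo-head (suc n) {f} p =
  trans (cong₂ ℤ._+_ (sumTo-head n p) (p n)) (ℤ.+-identityʳ (f 0))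

cst-⊛ : ∀ c f n k → (cst c ⊛ f) n k ≡ c ℤ.* f n k
cst-⊛ c f n k = trans
  (sumTo-head n (λ i → sumTo-zero k (λ j → ℤ.*-zeroˡ (f (n ∸ suc i) (k ∸ j)))))
  (sumTo-head k (λ j → ℤ.*-zeroˡ (f n (k ∸ suc j))))

𝕩-⊛-zero : ∀ f k → (𝕩 ⊛ f) 0 k ≡ + 0
𝕩-⊛-zero f k = sumTo-zero k (λ j → ℤ.*-zeroˡ (f 0 (k ∸ j)))

𝕩-⊛-suc : ∀ f n k → (𝕩 ⊛ f) (suc n) k ≡ f n k
𝕩-⊛-suc f n k = begin
  (𝕩 ⊛ f) (suc n) k ≡⟨ sumTo-suc n _ ⟩
  sumTo k (λ j → + 0 ℤ.* f (suc n) (k ∸ j)) ℤ.+ _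
    ≡⟨ cong₂ ℤ._+_ (sumTo-zero k (λ j → ℤ.*-zeroˡ (f (suc n) (k ∸ j)))) (sumTo-head n
         (λ i → sumTo-zero k (λ j → ℤ.*-zeroˡ (f (n ∸ suc i) (k ∸ j))))) ⟩
  + 0 ℤ.+ sumTo k (λ j → 𝕩 1 j ℤ.* f n (k ∸ j))
    ≡⟨ ℤ.+-identityˡ _ ⟩
  sumTo k (λ j → 𝕩 1 j ℤ.* f n (k ∸ j))
    ≡⟨ sumTo-head k (λ j → ℤ.*-zeroˡ (f n (k ∸ suc j))) ⟩
  + 1 ℤ.* f n k ≡⟨ ℤ.*-identityˡ (f n k) ⟩
  f n k ∎
  where open ≡-Reasoning

𝕪-⊛-zero : ∀ f n → (𝕪 ⊛ f) n 0 ≡ + 0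
𝕪-⊛-zero f n = trans
  (sumTo-head n (λ i → ℤ.*-zeroˡ (f (n ∸ suc i) 0)))
  (ℤ.*-zeroˡ (f n 0))

𝕪-⊛-suc : ∀ f n k → (𝕪 ⊛ f) n (suc k) ≡ f n k
𝕪-⊛-suc f n k = begin
  (𝕪 ⊛ f) n (suc k)
    ≡⟨ sumTo-head n (λ i → sumTo-zero (suc k) (λ j → ℤ.*-zeroˡ (f (n ∸ suc i) (suc k ∸ j)))) ⟩
  sumTo (suc k) (λ j → 𝕪 0 j ℤ.* f n (suc k ∸ j)) ≡⟨ sumTo-suc k _ ⟩
  + 0 ℤ.* f n (suc k) ℤ.+ sumTo k (λ j → 𝕪 0 (suc j) ℤ.* f n (k ∸ j))
    ≡⟨ cong₂ ℤ._+_ (ℤ.*-zeroˡ (f n (suc k))) (sumTo-head k (λ j → ℤ.*-zeroˡ (f n (k ∸ suc j)))) ⟩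
  + 0 ℤ.+ + 1 ℤ.* f n k ≡⟨ ℤ.+-identityˡ _ ⟩
  + 1 ℤ.* f n k ≡⟨ ℤ.*-identityˡ (f n k) ⟩
  f n k ∎
  where open ≡-Reasoning

δ : Bool → ℤ
δ b = if b then + 1 else + 0

𝕪-power : ∀ b n k → (𝕪 ^^ b) n k ≡ δ ((0 ≡ᵇ n) ∧ (b ≡ᵇ k))
𝕪-power zero    zero    zero    = refl
𝕪-power zero    zero    (suc k) = refl
𝕪-power zero    (suc n) k       = refl
𝕪-power (suc b) zero    zero    = 𝕪-⊛-zero (𝕪 ^^ b) 0
𝕪-power (suc b) (suc n) zero    = 𝕪-⊛-zero (𝕪 ^^ b) (suc n)
𝕪-power (suc b) n       (suc k) = trans (𝕪-⊛-suc (𝕪 ^^ b) n k) (𝕪-power b n k)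

𝕩-power-low : ∀ {a n} k → n ℕ.< a → (𝕩 ^^ a) n k ≡ + 0
𝕩-power-low {suc a} {zero}  k _         = 𝕩-⊛-zero (𝕩 ^^ a) k
𝕩-power-low {suc a} {suc n} k (s≤s n<a) =
  trans (𝕩-⊛-suc (𝕩 ^^ a) n k) (𝕩-power-low k n<a)

-- An exact identity at the coefficient of `x^n y^k` is read off in the ring truncated at just these
-- `n` and `k`.
⊛-assoc : ∀ f g h n k → (f ⊛ g ⊛ h) n k ≡ (f ⊛ (g ⊛ h)) n k
⊛-assoc f g h n k =
  CommutativeRing.*-assoc (TruncatedPS.commutativeRing n k) f g h ℕ.≤-refl ℕ.≤-refl

monomial : ∀ a b n k → (𝕩 ^^ a ⊛ 𝕪 ^^ b) n k ≡ δ ((a ≡ᵇ n) ∧ (b ≡ᵇ k))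
monomial zero    b n       k = trans (cst-⊛ (+ 1) (𝕪 ^^ b) n k)
  (trans (ℤ.*-identityˡ _) (𝕪-power b n k))
monomial (suc a) b zero    k = trans (⊛-assoc 𝕩 (𝕩 ^^ a) (𝕪 ^^ b) zero k)
  (𝕩-⊛-zero (𝕩 ^^ a ⊛ 𝕪 ^^ b) k)
monomial (suc a) b (suc n) k = trans (⊛-assoc 𝕩 (𝕩 ^^ a) (𝕪 ^^ b) (suc n) k)
  (trans (𝕩-⊛-suc (𝕩 ^^ a ⊛ 𝕪 ^^ b) n k) (monomial a b n k))

module _ (N K : ℕ) where
  open TruncatedPS N K
  open CommutativeRing commutativeRing using (_*_)
  -- With integers embedded by `cst`, the constants of the solver are the `𝟙`, `𝟚`, `𝟛` of the
  -- closed forms.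
  cst-morphism : CommutativeRing.rawRing ℤ.+-*-commutativeRing
                 -Raw-AlmostCommutative⟶ fromCommutativeRing commutativeRing
  cst-morphism = record
    { ⟦_⟧ = cst
    ; +-homo = λ a b {n} _ {k} _ → plus a b n k
    ; *-homo = λ a b {n} _ {k} _ → trans (times a b n k) (sym (cst-⊛ a (cst b) n k))
    ; -‿homo = λ a {n} _ {k} _ → neg a n k
    ; 0-homo = λ _ _ → refl
    ; 1-homo = λ _ _ → refl }
    where
    plus : ∀ a b n k → cst (a ℤ.+ b) n k ≡ cst a n k ℤ.+ cst b n k
    plus a b zero    zero    = refl
    plus a b zero    (suc k) = refl
    plus a b (suc n) k       = refl
    times : ∀ a b n k → cst (a ℤ.* b) n k ≡ a ℤ.* cst b n k
    times a b zero    zero    = refl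
    times a b zero    (suc k) = sym (ℤ.*-zeroʳ a)
    times a b (suc n) k       = sym (ℤ.*-zeroʳ a)
    neg : ∀ a n k → cst (ℤ.- a) n k ≡ ℤ.- cst a n k
    neg a zero    zero    = refl
    neg a zero    (suc k) = refl
    neg a (suc n) k       = refl

-- Occurrences in a first return decomposition

occ : List Step → Dyck → ℕ
occ p P = occurrences p (steps P)

-- A window of length 3 that starts inside u does not reach beyond a ∷ b.
occurrences-cut : ∀ p₁ p₂ p₃ u a b v → let p = p₁ ∷ p₂ ∷ p₃ ∷ [] in
  occurrences p (u ++ a ∷ b ∷ v) ≡ occurrences p (u ++ a ∷ b ∷ []) ℕ.+ occurrences p (a ∷ b ∷ v)
occurrences-cut p₁ p₂ p₃ [] a b v
  rewrite ∧-zeroʳ (p₂ ≟ˢ b) | ∧-zeroʳ (p₁ ≟ˢ a) | ∧-zeroʳ (p₁ ≟ˢ b) = refl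
occurrences-cut p₁ p₂ p₃ (c ∷ u) a b v = trans
  (cong₂ ℕ._+_ (window u) (occurrences-cut p₁ p₂ p₃ u a b v))
  (sym (ℕ.+-assoc (hit (c ∷ u ++ a ∷ b ∷ [])) _ _))
  where
  hit : List Step → ℕ
  hit w = if isPrefix (p₁ ∷ p₂ ∷ p₃ ∷ []) w then 1 else 0
  window : ∀ u → hit (c ∷ u ++ a ∷ b ∷ v) ≡ hit (c ∷ u ++ a ∷ b ∷ [])
  window []          = refl
  window (_ ∷ [])    = refl
  window (_ ∷ _ ∷ _) = refl

-- A nonempty path ends with UD or DD; at ε the value `D` is a mere default.
penultimate : Dyck → Step
penultimate P = if endsUD P then U else D

steps-end : ∀ α β → let P = ret α β in ∃ λ u → steps P ≡ u ++ penultimate P ∷ D ∷ []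
steps-end ε ε = [] , refl
steps-end α@(ret α₁ α₂) ε with steps-end α₁ α₂
... | u , eq = U ∷ u ++ penultimate α ∷ [] , cong (U ∷_)
  (trans (cong (_++ D ∷ []) eq) (trans (++-assoc u _ _) (sym (++-assoc u _ _))))
steps-end α (ret β γ) with steps-end β γ
... | u , eq = U ∷ steps α ++ D ∷ u , cong (U ∷_)
  (trans (cong (λ z → steps α ++ D ∷ z) eq) (sym (++-assoc (steps α) _ _)))

-- The cut is made before the last two steps of α: windows starting earlier stay inside
-- `U ∷ steps α`, and for the others only `penultimate α` is unknown.
occurrences-ret : ∀ p₁ p₂ p₃ α₁ α₂ β → let p = p₁ ∷ p₂ ∷ p₃ ∷ [] ; α = ret α₁ α₂ in
  occ p (ret α β) ≡ occurrences p (U ∷ steps α) ℕ.+ occurrences p (penultimate α ∷ D ∷ D ∷ steps β)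
occurrences-ret p₁ p₂ p₃ α₁ α₂ β with steps-end α₁ α₂
... | u , eq = cut (steps (ret α₁ α₂)) eq
  where
  p = p₁ ∷ p₂ ∷ p₃ ∷ []
  cut : ∀ {a} v → v ≡ u ++ a ∷ D ∷ [] → occurrences p (U ∷ v ++ D ∷ steps β) ≡
        occurrences p (U ∷ v) ℕ.+ occurrences p (a ∷ D ∷ D ∷ steps β)
  cut {a} _ refl = trans
    (cong (λ z → occurrences p (U ∷ z)) (++-assoc u (a ∷ D ∷ []) (D ∷ steps β)))
    (occurrences-cut p₁ p₂ p₃ (U ∷ u) a D (D ∷ steps β))

emptinessCount : ℕ → ℕ → Dyck → Dyck → ℕ
emptinessCount m n α β = if isEmpty β then 0 else if isEmpty α then m else n

peakCount : ℕ → ℕ → Dyck → ℕ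
peakCount m n α = if isEmpty α then 0 else if endsUD α then m else n

-- For nonempty α the leading `U` is followed by `U` and starts none of the four patterns, so the
-- first summand of `occurrences-ret` is the count in α. The junction is then computed for each
-- penultimate step.
occ-UDU : ∀ α β → occ pUDU (ret α β) ≡ occ pUDU α ℕ.+ occ pUDU β ℕ.+ emptinessCount 1 0 α β
occ-UDU ε         ε         = refl
occ-UDU ε         (ret _ _) = ℕ.+-comm 1 _
occ-UDU (ret α γ) β = trans (occurrences-ret U D U α γ β) (join (endsUD (ret α γ)) β)
  where
  m = occ pUDU (ret α γ)
  join : ∀ e β → m ℕ.+ occurrences pUDU ((if e then U else D) ∷ D ∷ D ∷ steps β) ≡
         m ℕ.+ occ pUDU β ℕ.+ (if isEmpty β then 0 else 0)
  join true  ε         = sym (ℕ.+-identityʳ _)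
  join false ε         = sym (ℕ.+-identityʳ _)
  join true  (ret _ _) = sym (ℕ.+-identityʳ _)
  join false (ret _ _) = sym (ℕ.+-identityʳ _)

occ-DDU : ∀ α β → occ pDDU (ret α β) ≡ occ pDDU α ℕ.+ occ pDDU β ℕ.+ emptinessCount 0 1 α β
occ-DDU ε         ε         = refl
occ-DDU ε         (ret _ _) = sym (ℕ.+-identityʳ _)
occ-DDU (ret α γ) β = trans (occurrences-ret D D U α γ β) (join (endsUD (ret α γ)) β)
  where
  m = occ pDDU (ret α γ)
  join : ∀ e β → m ℕ.+ occurrences pDDU ((if e then U else D) ∷ D ∷ D ∷ steps β) ≡
         m ℕ.+ occ pDDU β ℕ.+ (if isEmpty β then 0 else 1)
  join true  ε         = sym (ℕ.+-identityʳ _)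
  join false ε         = sym (ℕ.+-identityʳ _)
  join true  (ret _ _) = trans (cong (m ℕ.+_) (ℕ.+-comm 1 _)) (sym (ℕ.+-assoc m _ 1))
  join false (ret _ _) = trans (cong (m ℕ.+_) (ℕ.+-comm 1 _)) (sym (ℕ.+-assoc m _ 1))

occ-UDD : ∀ α β → occ pUDD (ret α β) ≡ occ pUDD α ℕ.+ occ pUDD β ℕ.+ peakCount 1 0 α
occ-UDD ε         ε         = refl
occ-UDD ε         (ret _ _) = sym (ℕ.+-identityʳ _)
occ-UDD (ret α γ) β = trans (occurrences-ret U D D α γ β) (join (endsUD (ret α γ)) β)
  where
  m = occ pUDD (ret α γ)
  join : ∀ e β → m ℕ.+ occurrences pUDD ((if e then U else D) ∷ D ∷ D ∷ steps β) ≡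
         m ℕ.+ occ pUDD β ℕ.+ (if e then 1 else 0)
  join true  ε         = sym (ℕ.+-assoc m 0 1)
  join false ε         = sym (ℕ.+-identityʳ _)
  join true  (ret _ _) = trans (cong (m ℕ.+_) (ℕ.+-comm 1 _)) (sym (ℕ.+-assoc m _ 1))
  join false (ret _ _) = sym (ℕ.+-identityʳ _)

occ-DDD : ∀ α β → occ pDDD (ret α β) ≡ occ pDDD α ℕ.+ occ pDDD β ℕ.+ peakCount 0 1 α
occ-DDD ε         ε         = refl
occ-DDD ε         (ret _ _) = sym (ℕ.+-identityʳ _)
occ-DDD (ret α γ) β = trans (occurrences-ret D D D α γ β) (join (endsUD (ret α γ)) β)
  where
  m = occ pDDD (ret α γ)
  join : ∀ e β → m ℕ.+ occurrences pDDD ((if e then U else D) ∷ D ∷ D ∷ steps β) ≡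
         m ℕ.+ occ pDDD β ℕ.+ (if e then 0 else 1)
  join true  ε         = sym (ℕ.+-identityʳ _)
  join false ε         = sym (ℕ.+-assoc m 0 1)
  join true  (ret _ _) = sym (ℕ.+-identityʳ _)
  join false (ret _ _) = trans (cong (m ℕ.+_) (ℕ.+-comm 1 _)) (sym (ℕ.+-assoc m _ 1))

-- Counting as a coefficient of a sum over trees

sumOver : {X : Set} → List X → (X → ℤ) → ℤ
sumOver []       f = + 0
sumOver (P ∷ Ps) f = f P ℤ.+ sumOver Ps f

sumOver-cong : {X : Set} (Ps : List X) {f g : X → ℤ} → (∀ P → f P ≡ g P) → sumOver Ps f ≡ sumOver Ps g
sumOver-cong []       p = refl
sumOver-cong (P ∷ Ps) p = cong₂ ℤ._+_ (p P) (sumOver-cong Ps p)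

sumOver-++ : {X : Set} (Ps Qs : List X) (f : X → ℤ) → sumOver (Ps ++ Qs) f ≡ sumOver Ps f ℤ.+ sumOver Qs f
sumOver-++ []       Qs f = sym (ℤ.+-identityˡ _)
sumOver-++ (P ∷ Ps) Qs f = trans (cong (ℤ._+_ (f P)) (sumOver-++ Ps Qs f)) (sym (ℤ.+-assoc (f P) _ _))

sumOver-map : {X Y : Set} (h : X → Y) (Ps : List X) (f : Y → ℤ) → sumOver (map h Ps) f ≡ sumOver Ps (f ∘ h)
sumOver-map h []       f = refl
sumOver-map h (P ∷ Ps) f = cong (ℤ._+_ (f (h P))) (sumOver-map h Ps f)

sumOver-concatMap : {X Y : Set} (h : X → List Y) (Ps : List X) (f : Y → ℤ) →
                    sumOver (concatMap h Ps) f ≡ sumOver Ps (λ P → sumOver (h P) f)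
sumOver-concatMap h []       f = refl
sumOver-concatMap h (P ∷ Ps) f = trans (sumOver-++ (h P) _ f)
  (cong (ℤ._+_ (sumOver (h P) f)) (sumOver-concatMap h Ps f))

sumOver-filter : {X : Set} {Q : X → Set} (Q? : Decidable Q) (Ps : List X) (f : X → ℤ) →
                 sumOver (filter Q? Ps) f ≡ sumOver Ps (λ P → if does (Q? P) then f P else + 0)
sumOver-filter Q? []       f = refl
sumOver-filter Q? (P ∷ Ps) f with does (Q? P)
... | true  = cong (ℤ._+_ (f P)) (sumOver-filter Q? Ps f)
... | false = trans (sumOver-filter Q? Ps f) (sym (ℤ.+-identityˡ _))

length≡sumOver : {X : Set} (Ps : List X) → + length Ps ≡ sumOver Ps (λ _ → + 1)
length≡sumOver []       = refl
length≡sumOver (P ∷ Ps) = cong (ℤ._+_ (+ 1)) (length≡sumOver Ps)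

indicator : List Step → ℕ → ℕ → Dyck → ℤ
indicator p n k P = δ (inDh≥ P ∧ (semilength P ≡ᵇ n) ∧ (occ p P ≡ᵇ k))

F≡sumOver : ∀ p n k → F p n k ≡ sumOver (boundedDyck n) (indicator p n k)
F≡sumOver p n k = begin
  + count p n k
    ≡⟨ length≡sumOver (filter occ? (filter in? (allDyck n))) ⟩
  sumOver (filter occ? (filter in? (allDyck n))) (λ _ → + 1)
    ≡⟨ sumOver-filter occ? (filter in? (allDyck n)) _ ⟩
  sumOver (filter in? (allDyck n)) _ ≡⟨ sumOver-filter in? (allDyck n) _ ⟩
  sumOver (allDyck n) _ ≡⟨ sumOver-filter (λ P → semilength P ℕ.≟ n) (boundedDyck n) _ ⟩
  sumOver (boundedDyck n) _ ≡⟨ sumOver-cong (boundedDyck n) (λ P → merge (inDh≥ P) (semilength P ≡ᵇ n) (occ p P ≡ᵇ k)) ⟩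
  sumOver (boundedDyck n) (indicator p n k) ∎
  where
  open ≡-Reasoning
  occ? = λ P → occ p P ℕ.≟ k
  in? = λ P → inDh≥ P Bool.≟ true
  merge : ∀ i s o → (if s then if does (i Bool.≟ true) then δ o else + 0 else + 0) ≡ δ (i ∧ s ∧ o)
  merge true  true  o = refl
  merge true  false o = refl
  merge false true  o = refl
  merge false false o = refl

-- Paths weighted by monomials modulo x^(N+1)

module Coefficients (N K : ℕ) where
  open TruncatedPS N K using (commutativeRing; _≈ᴺ_)
  open CommutativeRing commutativeRing using (semiring)
  open import Algebra.Properties.Semiring.Exp semiring using (_^_; ^-homo-*)
  module R = CommutativeRing commutativeRing

  ^≡^^ : ∀ f m → f ^ m ≡ f ^^ m
  ^≡^^ f zero    = refl
  ^≡^^ f (suc m) = cong (f ⊛_) (^≡^^ f m)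

  -- Coefficients up to `x^N` inclusive are compared, so the nilpotency exponent, and with it the
  -- depth of `Σᴰ`, is `suc N`.
  𝕩-nilpotent : 𝕩 ^ suc N ≈ᴺ cst (+ 0)
  𝕩-nilpotent {n} n≤N {k} _ rewrite ^≡^^ 𝕩 N =
    trans (𝕩-power-low k (s≤s n≤N)) (sym (TruncatedPS.cst0 N K n k))

  open NilpotentRing commutativeRing (cst-morphism N K) public
  open Nilpotent 𝕩 (suc N) 𝕩-nilpotent public

  ∑-coefficient : ∀ d f n k → ∑ d f n k ≡ sumOver (boundedDyck d) (λ P → f P n k)
  ∑-coefficient zero    f n k = sym (ℤ.+-identityʳ _)
  ∑-coefficient (suc d) f n k = cong (ℤ._+_ (f ε n k)) (begin
    ∑ d (λ α → ∑ d (λ β → f (ret α β))) n k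
      ≡⟨ ∑-coefficient d _ n k ⟩
    sumOver Ps (λ α → ∑ d (λ β → f (ret α β)) n k)
      ≡⟨ sumOver-cong Ps (λ α → trans (∑-coefficient d _ n k) (sym (sumOver-map (ret α) Ps _))) ⟩
    sumOver Ps (λ α → sumOver (map (ret α) Ps) (λ P → f P n k))
      ≡⟨ sumOver-concatMap (λ α → map (ret α) Ps) Ps _ ⟨
    sumOver (concatMap (λ α → map (ret α) Ps) Ps) (λ P → f P n k) ∎)
    where
    open ≡-Reasoning
    Ps = boundedDyck d

  module Pattern (p : List Step) (occ-ε : occ p ε ≡ 0) where
    wt : Dyck → PS
    wt P = 𝕩 ^^ semilength P ⊛ 𝕪 ^^ occ p P

    wt-small : Small wt
    wt-small P N≤P {n} n≤N {k} _ = trans (monomial (semilength P) (occ p P) n k)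
      (trans (cong (λ b → δ (b ∧ (occ p P ≡ᵇ k))) (≡ᵇ-false (ℕ.>⇒≢ (ℕ.≤-trans (s≤s n≤N) N≤P))))
             (sym (TruncatedPS.cst0 N K n k)))

    summand : Dyck → PS
    summand P = 𝟏 (inDh≥ P) ⊛ wt P ⊛ cst (+ 1)

    summand-coefficient : ∀ P n k → summand P n k ≡ indicator p n k P
    summand-coefficient P n k = trans
      (CommutativeRing.*-identityʳ (TruncatedPS.commutativeRing n k) (𝟏 (inDh≥ P) ⊛ wt P) ℕ.≤-refl ℕ.≤-refl)
      (restrict (inDh≥ P))
      where
      restrict : ∀ b → (𝟏 b ⊛ wt P) n k ≡ δ (b ∧ (semilength P ≡ᵇ n) ∧ (occ p P ≡ᵇ k))
      restrict true  = trans (cst-⊛ (+ 1) (wt P) n k)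
        (trans (ℤ.*-identityˡ _) (monomial (semilength P) (occ p P) n k))
      restrict false = trans (cst-⊛ (+ 0) (wt P) n k) (ℤ.*-zeroˡ (wt P n k))

    wt-ε : wt ε ≈ᴺ cst (+ 1)
    wt-ε rewrite occ-ε = CommutativeRing.*-identityˡ commutativeRing (cst (+ 1))

    open Weighted wt wt-small wt-ε public

    power-+ : ∀ f a b → f ^^ (a ℕ.+ b) ≈ᴺ f ^^ a ⊛ f ^^ b
    power-+ f a b rewrite sym (^≡^^ f (a ℕ.+ b)) | sym (^≡^^ f a) | sym (^≡^^ f b) = ^-homo-* f a b

    wt-ret : ∀ α β c → occ p (ret α β) ≡ occ p α ℕ.+ occ p β ℕ.+ c →
             wt (ret α β) ≈ᴺ 𝕩 ⊛ (wt α ⊛ wt β ⊛ 𝕪 ^^ c)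
    wt-ret α β c eq rewrite eq = R.trans
      (R.*-cong (R.*-congˡ {𝕩} (power-+ 𝕩 (semilength α) (semilength β)))
        (R.trans (power-+ 𝕪 (occ p α ℕ.+ occ p β) c) (R.*-congʳ {𝕪 ^^ c} (power-+ 𝕪 (occ p α) (occ p β)))))
      (regroup 𝕩 (𝕩 ^^ semilength α) (𝕩 ^^ semilength β) (𝕪 ^^ occ p α) (𝕪 ^^ occ p β) (𝕪 ^^ c))

-- The count for `x^n` uses depth `n`, the ring argument a common depth. Trees new at greater depth
-- have semilength above `n`, so their monomials vanish in the ring truncated at `n` and `k`.
summation-stable : ∀ p → occ p ε ≡ 0 → ∀ n k e →
  sumOver (boundedDyck (e ℕ.+ n)) (indicator p n k) ≡ sumOver (boundedDyck n) (indicator p n k)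
summation-stable p occ-ε n k zero    = refl
summation-stable p occ-ε n k (suc e) = trans step (summation-stable p occ-ε n k e)
  where
  open Coefficients n k
  open Pattern p occ-ε
  as-∑ : ∀ d → sumOver (boundedDyck d) (indicator p n k) ≡ ∑ d summand n k
  as-∑ d = sym (trans (∑-coefficient d summand n k)
    (sumOver-cong (boundedDyck d) (λ P → summand-coefficient P n k)))
  step : sumOver (boundedDyck (suc e ℕ.+ n)) (indicator p n k) ≡
         sumOver (boundedDyck (e ℕ.+ n)) (indicator p n k)
  step = trans (as-∑ (suc e ℕ.+ n)) (trans
    (∑-stable (e ℕ.+ n) summand
      (λ P d<P → summand-small inDh≥ 𝕀 P (ℕ.≤-<-trans (ℕ.m≤n+m n e) d<P)) ℕ.≤-refl ℕ.≤-refl)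
    (sym (as-∑ (e ℕ.+ n))))

module GeneratingFunction (N K : ℕ) (p : List Step) (occ-ε : occ p ε ≡ 0) where
  open Coefficients N K
  open Pattern p occ-ε
  open TruncatedPS N K using (commutativeRing; _≈ᴺ_)

  F≈gf : F p ≈ᴺ gf inDh≥ 𝕀
  F≈gf {n} n≤N {k} _ = begin
    F p n k                                                          ≡⟨ F≡sumOver p n k ⟩
    sumOver (boundedDyck n) (indicator p n k)                        ≡⟨ summation-stable p occ-ε n k (suc N ∸ n) ⟨
    sumOver (boundedDyck (suc N ∸ n ℕ.+ n)) (indicator p n k)
      ≡⟨ cong (λ d → sumOver (boundedDyck d) (indicator p n k)) (ℕ.m∸n+n≡m (ℕ.m≤n⇒m≤1+n n≤N)) ⟩
    sumOver (boundedDyck (suc N)) (indicator p n k)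
      ≡⟨ sumOver-cong (boundedDyck (suc N)) (λ P → summand-coefficient P n k) ⟨
    sumOver (boundedDyck (suc N)) (λ P → summand P n k)
      ≡⟨ ∑-coefficient (suc N) summand n k ⟨
    gf inDh≥ 𝕀 n k ∎
    where open ≡-Reasoning

-- The four closed forms

emptinessFactor-power : ∀ N K m n α β →
  𝕪 ^^ emptinessCount m n α β ≡ Coefficients.emptinessFactor N K (𝕪 ^^ m) (𝕪 ^^ n) α β
emptinessFactor-power N K m n α         ε         = refl
emptinessFactor-power N K m n ε         (ret _ _) = refl
emptinessFactor-power N K m n (ret _ _) (ret _ _) = refl

peakFactor-power : ∀ N K m n α →
  𝕪 ^^ peakCount m n α ≡ Coefficients.peakFactor N K (𝕪 ^^ m) (𝕪 ^^ n) α
peakFactor-power N K m n ε = refl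
peakFactor-power N K m n α@(ret _ _) with endsUD α
... | true  = refl
... | false = refl

module ClosedForms (N K : ℕ) where
  open TruncatedPS N K using (_≈ᴺ_)
  open Coefficients N K
  open Algebra.Solver.Ring ℤ-rawRing (fromCommutativeRing (TruncatedPS.commutativeRing N K))
    (cst-morphism N K) ι-≟ using (Polynomial; solve; _:=_; _:+_; _:*_; _:-_; con; _:^_)

  private
    one two three : ∀ {m} → Polynomial m
    one   = con (+ 1)
    two   = con (+ 2)
    three = con (+ 3)

    -- Polynomial copies of the quantities of the two crossing modules, shaped like them so that the
    -- solved identities have the required types by computation.
    disc-poly : ∀ {m} (q w j : Polynomial m) → Polynomial m
    disc-poly q w j = (j :- two :* q :* w) :* (j :+ two :* q :* w)

    root-poly : ∀ {m} (q w j f : Polynomial m) → Polynomial m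
    root-poly q w j f = j :- two :* q :* q :* w :* f

    w-poly j-poly : ∀ {m} (x u v : Polynomial m) → Polynomial m
    w-poly x u v = one :- x :* u :+ x :* v
    j-poly x u v = (one :+ x :* x) :* (one :- x :* u) :+ (x :* x :- x) :* (x :* v)

    q-peak-poly j-peak-poly : ∀ {m} (x s t : Polynomial m) → Polynomial m
    q-peak-poly x s t = x :* (t :+ (s :- t) :* x)
    j-peak-poly x s t = one :- x :- s :* x :* x :+ q-peak-poly x s t :* (x :* t)

  conclude : ∀ {p N′ Den H g root disc} → F p ≈ᴺ g → root ⊛ root ≈ᴺ disc →
    N′ ⊝ Den ⊛ g ≈ᴺ root → disc ≈ᴺ H → (N′ ⊝ Den ⊛ F p) ⊛ (N′ ⊝ Den ⊛ F p) ≈ᴺ H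
  conclude {p} {N′} {Den} {H} {g} {root} {disc} F≈ root² N≈ disc≈ =
    R.trans (R.*-cong G≈ G≈) (R.trans root² disc≈)
    where
    G≈ : N′ ⊝ Den ⊛ F p ≈ᴺ root
    G≈ = R.trans (R.+-congˡ {N′} (R.-‿cong (R.*-congˡ {Den} F≈))) N≈

  module UDU where
    open Pattern pUDU refl
    open GeneratingFunction N K pUDU refl using (F≈gf)

    wt-UDU : ∀ α β → wt (ret α β) ≈ᴺ 𝕩 ⊛ (wt α ⊛ wt β ⊛ emptinessFactor (𝕪 ^^ 1) (𝕪 ^^ 0) α β)
    wt-UDU α β rewrite sym (emptinessFactor-power N K 1 0 α β) = wt-ret α β _ (occ-UDU α β)

    open EmptinessCrossing (𝕪 ^^ 1) (𝕪 ^^ 0) wt-UDU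

    root≈ : N-UDU ⊝ Den-UDU ⊛ gf inDh≥ 𝕀 ≈ᴺ root
    root≈ = solve 3 (λ x y f →
      one :+ x :* (x :^ 2 :- x :^ 2 :* y :- y) :- two :* x :^ 2 :* (x :- x :* y :+ one) :* f
      -- Here `v = 1`, so `v F + (1 − v)` appears with `one` for `v`.
      := root-poly (x :* one) (w-poly x (y :^ 1) one) (j-poly x (y :^ 1) one) (one :* f :+ (one :- one)))
      (λ _ _ → refl) 𝕩 𝕪 (gf inDh≥ 𝕀)

    disc≈ : disc ≈ᴺ Aₚ
    disc≈ = solve 2 (λ x y →
      disc-poly (x :* one) (w-poly x (y :^ 1) one) (j-poly x (y :^ 1) one)
      := (x :+ one) :* (x :^ 2 :* y :- x :^ 2 :+ x :* y :- x :- one)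
         :* (x :^ 3 :* y :- x :^ 3 :- two :* x :^ 2 :* y :+ two :* x :^ 2 :+ x :* y :+ two :* x :- one))
      (λ _ _ → refl) 𝕩 𝕪

    square : (N-UDU ⊝ Den-UDU ⊛ F pUDU) ⊛ (N-UDU ⊝ Den-UDU ⊛ F pUDU) ≈ᴺ Aₚ
    square = conclude {pUDU} {N-UDU} {Den-UDU} {Aₚ} {gf inDh≥ 𝕀} {root} {disc} F≈gf root² root≈ disc≈

  module DDU where
    open Pattern pDDU refl
    open GeneratingFunction N K pDDU refl using (F≈gf)

    wt-DDU : ∀ α β → wt (ret α β) ≈ᴺ 𝕩 ⊛ (wt α ⊛ wt β ⊛ emptinessFactor (𝕪 ^^ 0) (𝕪 ^^ 1) α β)
    wt-DDU α β rewrite sym (emptinessFactor-power N K 0 1 α β) = wt-ret α β _ (occ-DDU α β)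

    open EmptinessCrossing (𝕪 ^^ 0) (𝕪 ^^ 1) wt-DDU

    root≈ : N-DDU ⊝ Den-DDU ⊛ gf inDh≥ 𝕀 ≈ᴺ root
    root≈ = solve 3 (λ x y f →
      one :+ x :* (two :* x :^ 2 :* y :^ 2 :- three :* x :^ 2 :* y :+ x :^ 2 :+ x :* y :- x :- one)
      :- two :* x :^ 2 :* y :* (x :* y :- x :+ one) :* f
      -- Here `v = y`: the term `1 − y` goes into `N-DDU` and the factor `y` of `F` into `Den-DDU`.
      := root-poly (x :* one) (w-poly x one (y :^ 1)) (j-poly x one (y :^ 1)) ((y :^ 1) :* f :+ (one :- y :^ 1)))
      (λ _ _ → refl) 𝕩 𝕪 (gf inDh≥ 𝕀)

    disc≈ : disc ≈ᴺ Cₚ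
    disc≈ = solve 2 (λ x y →
      disc-poly (x :* one) (w-poly x one (y :^ 1)) (j-poly x one (y :^ 1))
      := (x :+ one) :* (x :^ 2 :* y :- x :^ 2 :+ one)
         :* (x :^ 3 :* y :- x :^ 3 :- three :* x :^ 2 :* y :+ three :* x :^ 2 :- three :* x :+ one))
      (λ _ _ → refl) 𝕩 𝕪

    square : (N-DDU ⊝ Den-DDU ⊛ F pDDU) ⊛ (N-DDU ⊝ Den-DDU ⊛ F pDDU) ≈ᴺ Cₚ
    square = conclude {pDDU} {N-DDU} {Den-DDU} {Cₚ} {gf inDh≥ 𝕀} {root} {disc} F≈gf root² root≈ disc≈

  module UDD where
    open Pattern pUDD refl
    open GeneratingFunction N K pUDD refl using (F≈gf)

    wt-UDD : ∀ α β → wt (ret α β) ≈ᴺ 𝕩 ⊛ (wt α ⊛ wt β ⊛ peakFactor (𝕪 ^^ 1) (𝕪 ^^ 0) α)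
    wt-UDD α β rewrite sym (peakFactor-power N K 1 0 α) = wt-ret α β _ (occ-UDD α β)

    open PeakCrossing (𝕪 ^^ 1) (𝕪 ^^ 0) wt-UDD

    root≈ : N-UDD ⊝ Den-UDD ⊛ gf inDh≥ 𝕀 ≈ᴺ root
    root≈ = solve 3 (λ x y f →
      one :+ x :* (x :^ 2 :* y :- x :^ 2 :- x :* y :+ x :- one)
      :- two :* x :^ 2 :* (x :* y :- x :+ one) :^ 2 :* f
      := root-poly (q-peak-poly x (y :^ 1) one) one (j-peak-poly x (y :^ 1) one) f)
      (λ _ _ → refl) 𝕩 𝕪 (gf inDh≥ 𝕀)

    disc≈ : disc ≈ᴺ Bₚ
    disc≈ = solve 2 (λ x y →
      disc-poly (q-peak-poly x (y :^ 1) one) one (j-peak-poly x (y :^ 1) one)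
      := (x :+ one) :* (x :^ 2 :* y :- x :^ 2 :+ one)
         :* (x :^ 3 :* y :- x :^ 3 :- three :* x :^ 2 :* y :+ three :* x :^ 2 :- three :* x :+ one))
      (λ _ _ → refl) 𝕩 𝕪

    square : (N-UDD ⊝ Den-UDD ⊛ F pUDD) ⊛ (N-UDD ⊝ Den-UDD ⊛ F pUDD) ≈ᴺ Bₚ
    square = conclude {pUDD} {N-UDD} {Den-UDD} {Bₚ} {gf inDh≥ 𝕀} {root} {disc} F≈gf root² root≈ disc≈

  module DDD where
    open Pattern pDDD refl
    open GeneratingFunction N K pDDD refl using (F≈gf)

    wt-DDD : ∀ α β → wt (ret α β) ≈ᴺ 𝕩 ⊛ (wt α ⊛ wt β ⊛ peakFactor (𝕪 ^^ 0) (𝕪 ^^ 1) α)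
    wt-DDD α β rewrite sym (peakFactor-power N K 0 1 α) = wt-ret α β _ (occ-DDD α β)

    open PeakCrossing (𝕪 ^^ 0) (𝕪 ^^ 1) wt-DDD

    root≈ : N-DDD ⊝ Den-DDD ⊛ gf inDh≥ 𝕀 ≈ᴺ root
    root≈ = solve 3 (λ x y f →
      one :- x :* (x :^ 2 :* y :^ 2 :- x :^ 2 :* y :- x :* y :^ 2 :+ x :+ one)
      :- two :* x :^ 2 :* (x :* y :- x :- y) :^ 2 :* f
      -- Here `q = −x (x y − x − y)`, whose sign disappears in `q²`.
      := root-poly (q-peak-poly x one (y :^ 1)) one (j-peak-poly x one (y :^ 1)) f)
      (λ _ _ → refl) 𝕩 𝕪 (gf inDh≥ 𝕀)

    disc≈ : disc ≈ᴺ Dₚ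
    disc≈ = solve 2 (λ x y →
      disc-poly (q-peak-poly x one (y :^ 1)) one (j-peak-poly x one (y :^ 1))
      := (x :* y :+ one) :* (x :^ 2 :* y :- x :^ 2 :- x :* y :+ x :- one)
         :* (x :^ 3 :* y :^ 2 :- x :^ 3 :* y :- x :^ 2 :* y :^ 2 :- two :* x :^ 2 :* y
             :+ three :* x :^ 2 :+ two :* x :* y :+ x :- one))
      (λ _ _ → refl) 𝕩 𝕪

    square : (N-DDD ⊝ Den-DDD ⊛ F pDDD) ⊛ (N-DDD ⊝ Den-DDD ⊛ F pDDD) ≈ᴺ Dₚ
    square = conclude {pDDD} {N-DDD} {Den-DDD} {Dₚ} {gf inDh≥ 𝕀} {root} {disc} F≈gf root² root≈ disc≈

theorem12 : ClosedForm (F pUDU) N-UDU Aₚ Den-UDU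
    × ClosedForm (F pUDD) N-UDD Bₚ Den-UDD
    × ClosedForm (F pDDU) N-DDU Cₚ Den-DDU
    × ClosedForm (F pDDD) N-DDD Dₚ Den-DDD
theorem12 =
  -- Each coefficient is read in the ring truncated at its own indices; the constant term of the
  -- root evaluates to 1.
  ((λ n k → ClosedForms.UDU.square n k ℕ.≤-refl ℕ.≤-refl) , refl) ,
  ((λ n k → ClosedForms.UDD.square n k ℕ.≤-refl ℕ.≤-refl) , refl) ,
  ((λ n k → ClosedForms.DDU.square n k ℕ.≤-refl ℕ.≤-refl) , refl) ,
  ((λ n k → ClosedForms.DDD.square n k ℕ.≤-refl ℕ.≤-refl) , refl)
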